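{- Let $n\geq 3$. The base-cobase graph $G(\mathcal{W}^n,(\mathcal{W}^n)^\ast)$ of the whirl $\mathcal{W}^n$ is Hamiltonian connected, i.e. for any two distinct vertices $u,v$ it has a Hamiltonian path with endpoints $u$ and $v$.
   Context: The wheel graph $\mathcal{W}_n$ ($n\ge 3$) has vertices $c,v_1,\dots,v_n$, rim edges $v_iv_{i+1}$ (indices mod $n$) and spokes $cv_i$. The whirl $\mathcal{W}^n$ is the matroid on the edge set of $\mathcal{W}_n$ whose bases are the edge sets of spanning trees of $\mathcal{W}_n$ together with the set of all $n$ rim edges. For a matroid $M$ on $E$, a base-cobase is a base $B$ such that $E\setminus B$ is also a base; the base-cobase graph $G(M,M^\ast)$ has the base-cobases as vertices, two being adjacent iff their symmetric difference has exactly two elements. -}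

module Defs where

open import Data.Nat using (ℕ; zero; suc; _<?_; _≤_)
open import Data.Fin using (Fin; toℕ; fromℕ<; splitAt)
open import Data.Fin.Subset using (Subset; _∈_; _─_; _∪_; ∣_∣; ∁; ⁅_⁆)
open import Data.Maybe using (Maybe; just; nothing)
open import Data.Product using (_×_; _,_; Σ-syntax)
open import Data.Sum using (_⊎_; inj₁; inj₂)
open import Data.List using (List; []; _∷_; _++_)
open import Data.List.Relation.Unary.All using (All)
open import Data.List.Relation.Unary.Linked using (Linked)
open import Data.List.Relation.Unary.Unique.Propositional using (Unique)
import Data.List.Membership.Propositional as LM
open import Relation.Binary.PropositionalEquality using (_≡_)
open import Relation.Nullary using (¬_; yes; no)

next : ∀ {n} → Fin n → Fin n
next {suc m} i with suc (toℕ i) <? suc m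
... | yes p = fromℕ< p
... | no _  = Fin.zero

-- Vertices of the wheel W_n: nothing = centre c, just i = rim vertex v_i.
Vertex : ℕ → Set
Vertex n = Maybe (Fin n)

-- Edges of W_n: Fin (n + n); the first n are the rim edges
-- r_i = v_i v_{i+1}, the last n are the spokes s_i = c v_i.
Edge : ℕ → Set
Edge n = Fin (n Data.Nat.+ n)

EdgeSet : ℕ → Set
EdgeSet n = Subset (n Data.Nat.+ n)

ends : ∀ {n} → Edge n → Vertex n × Vertex n
ends {n} e with splitAt n e
... | inj₁ i = just i , just (next i)
... | inj₂ i = nothing , just i

Joins : ∀ {n} → Edge n → Vertex n → Vertex n → Set
Joins {n} e x y = (ends e ≡ (x , y)) ⊎ (ends e ≡ (y , x))

data Reach (n : ℕ) (S : EdgeSet n) : Vertex n → Vertex n → Set where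
  here : ∀ {x} → Reach n S x x
  step : ∀ {x y z} (e : Edge n) → e ∈ S → Joins e x y → Reach n S y z → Reach n S x z

Connected : (n : ℕ) → EdgeSet n → Set
Connected n S = (x y : Vertex n) → Reach n S x y

IsSpanningTree : (n : ℕ) → EdgeSet n → Set
IsSpanningTree n S = Connected n S × ((e : Edge n) → e ∈ S → ¬ Connected n (S ─ ⁅ e ⁆))

IsRim : ∀ {n} → Edge n → Set
IsRim {n} e with splitAt n e
... | inj₁ _ = Data.Unit.⊤ where import Data.Unit
... | inj₂ _ = Data.Empty.⊥ where import Data.Empty

IsRimSet : (n : ℕ) → EdgeSet n → Set
IsRimSet n S = (e : Edge n) → (e ∈ S → IsRim {n} e) × (IsRim {n} e → e ∈ S)

IsWhirlBase : (n : ℕ) → EdgeSet n → Set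
IsWhirlBase n S = IsSpanningTree n S ⊎ IsRimSet n S

IsBaseCobase : (n : ℕ) → EdgeSet n → Set
IsBaseCobase n B = IsWhirlBase n B × IsWhirlBase n (∁ B)

Adjacent : (n : ℕ) → EdgeSet n → EdgeSet n → Set
Adjacent n B B' = ∣ (B ─ B') ∪ (B' ─ B) ∣ ≡ 2

HamiltonianPath : (n : ℕ) → EdgeSet n → EdgeSet n → Set
HamiltonianPath n u v =
  Σ[ mid ∈ List (EdgeSet n) ]
    let P = u ∷ (mid ++ v ∷ []) in
    All (IsBaseCobase n) P × Linked (Adjacent n) P × Unique P
    × ((B : EdgeSet n) → IsBaseCobase n B → B LM.∈ P)

{-# OPTIONS --safe #-}
-- On the cyclic sequence s₀ r₀ s₁ r₁ … of spokes and rim edges, mark the spokes in B and the rim edges not in B.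
-- Then B is a base of the whirl iff the marks alternate between spokes and rim edges, hence B is a base-cobase iff
-- all runs of marks and of gaps have even length, i.e. iff the word is constant on the pairs (sᵢ, rᵢ) or constant
-- on the pairs (rᵢ, sᵢ₊₁). So the vertices form two n-dimensional cubes sharing the two constant words (the poles).
-- Adjacent words are neighbours in a cube, or joined by a bridge between the cubes; in particular the two copies of
-- a word next to a pole are joined.  Hamiltonian paths are assembled from covers of the cubes by one or two paths
-- with prescribed ends, possibly missing one vertex, which change cubes at a pole or at a bridge; a path cut short
-- just before a pole always ends at a bridge.  The cases differ by the parities of n and of the two ends.
module Submission where

open import Defs
open import Data.Nat using (ℕ; zero; suc; _+_; _<_; _≤_; _<?_; s≤s; z≤n)
import Data.Nat.Properties as ℕ
open import Data.Bool using (Bool; true; false; not; _xor_)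
import Data.Bool.Properties as Bool
open import Data.Fin using (Fin; zero; suc; toℕ; fromℕ; inject₁; _↑ˡ_; _↑ʳ_; splitAt)
import Data.Fin.Properties as Fin
open import Data.Fin.Induction using (<-weakInduction; >-weakInduction)
open import Data.Fin.Relation.Unary.Top using (view; ‵fromℕ; ‵inject₁)
open import Data.Fin.Subset using (_─_; _∪_; ∁; ⁅_⁆; ∣_∣) renaming (_∈_ to _∈ˢ_)
import Data.Fin.Subset.Properties as Subset
open import Data.Vec using (Vec; []; _∷_; lookup; insertAt; removeAt; updateAt; replicate; tabulate; here; there)
import Data.Vec as Vec
import Data.Vec.Properties as Vec
open import Data.List using (List; []; _∷_; _++_; map; [_]; concatMap; head)
import Data.List.Properties as List
open import Data.List.Membership.Propositional using (_∈_)
open import Data.List.Membership.Propositional.Properties using (∈-++⁺ˡ; ∈-++⁺ʳ; ∈-++⁻; ∈-map⁻; ∈-map⁺; ∈-∃++)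
open import Data.List.Relation.Unary.Any using (here; there)
open import Data.List.Relation.Unary.All using (_∷_)
import Data.List.Relation.Unary.All as All
open import Data.List.Relation.Unary.AllPairs using ([]; _∷_)
open import Data.List.Relation.Unary.Linked using (Linked; [-]; _∷_)
open import Data.List.Relation.Unary.Unique.Propositional using (Unique)
import Data.List.Relation.Unary.Unique.Propositional.Properties as Unique
open import Data.List.Relation.Binary.Permutation.Propositional
open import Data.List.Relation.Binary.Permutation.Propositional.Properties hiding (map⁺)
import Data.List.Relation.Binary.Permutation.Propositional.Properties as Perm
import Data.List.Relation.Binary.Permutation.Setoid.Properties as SetoidPerm
import Algebra.Solver.CommutativeMonoid as CMSolver
open import Data.Maybe using (Maybe; just; nothing; is-just)
import Data.Maybe as Maybe
open import Data.Maybe.Properties using (just-injective)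
open import Data.Product using (∃-syntax; _×_; _,_; proj₁; proj₂)
open import Data.Sum using (_⊎_; inj₁; inj₂)
open import Data.Unit using (⊤)
open import Data.Empty using (⊥; ⊥-elim)
open import Relation.Nullary using (¬_; Dec; yes; no; contradiction)
open import Relation.Nullary.Decidable using (map′; _→-dec_; _×-dec_; ¬?; toWitness)
open import Relation.Binary.PropositionalEquality using (_≡_; _≢_; cong; cong₂; subst; subst₂; ≢-sym; setoid; module ≡-Reasoning)
import Relation.Binary.PropositionalEquality as Eq
open import Function using (_∘_; id)

-- A parity count dictates how often a path has to use a bridge between the two copies of a word.
-- Parity alternates along cube edges, while such a bridge joins vertices of equal parity. For odd n
-- the poles have different parity, and after gluing both parities occur equally often. Ends of
-- opposite parity need no bridge; two ends of parity `b` need one next to `pole b`, where the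
-- copies have the other parity. The two poles themselves are special: without a bridge a path
-- between them could never leave its cube. For even n both poles are even, so after gluing the odd
-- vertices outnumber the even ones by two, and all these bridges join odd vertices. A path with k
-- bridges splits into k + 1 alternating pieces; the count then forces one bridge between two odd
-- ends, two between ends of different parity, and three between two even ends. The last case is the
-- hardest, since one visit to each cube no longer suffices and the cubes have to be cut into
-- halves.

module ↭-Solver {A : Set} = CMSolver (++-commutativeMonoid {A = A})
open ↭-Solver using (solve; _⊜_; _⊕_)

-- Paths and their supports

private variable
  n : ℕ
  V W : Set
  R : V → V → Set

data Path {V : Set} (R : V → V → Set) : V → V → List V → Set where
  stop : ∀ {x} → Path R x x [ x ]
  _▸_  : ∀ {x y z l} → R x y → Path R y z l → Path R x z (x ∷ l)

infixr 5 _▸_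

-- The support is fixed only up to permutation, so the supports of assembled tours can be compared
-- by the commutative monoid solver.
Tour : {V : Set} → (V → V → Set) → V → V → List V → Set
Tour R x y L = ∃[ l ] Path R x y l × l ↭ L

tour-resp : ∀ {x y L M} → L ↭ M → Tour {V} R x y L → Tour R x y M
tour-resp p (l , π , q) = l , π , ↭-trans q p

path-join : ∀ {x y z w l m} → Path {V} R x y l → R y z → Path R z w m → Path R x w (l ++ m)
path-join stop    r π = r ▸ π
path-join (s ▸ ρ) r π = s ▸ path-join ρ r π

join : ∀ {x y z w L M} → Tour {V} R x y L → R y z → Tour R z w M → Tour R x w (L ++ M)
join (l , π , p) r (m , ρ , q) = l ++ m , path-join π r ρ , ++⁺ p q

reverse-tour : (∀ {a b} → R a b → R b a) → ∀ {x y L} → Tour {V} R x y L → Tour R y x L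
reverse-tour {V} {R} R-sym (l , π , p) = proj₁ (rev π) , proj₁ (proj₂ (rev π)) , ↭-trans (proj₂ (proj₂ (rev π))) p
  where
  rev : ∀ {x y l} → Path R x y l → Tour R y x l
  rev stop = _ , stop , ↭-refl
  rev {x} (_▸_ {l = l} r π) with m , ρ , q ← rev π =
    m ++ [ x ] , path-join ρ (R-sym r) stop , ↭-trans (++-comm m [ x ]) (prep x q)

-- Both supports contain the common vertex `y`, which the combined tour visits once; so one copy is
-- given back. This is how a tour changes cubes at a pole.
glue : ∀ {x y z L M} → Tour {V} R x y L → Tour R y z M → ∃[ K ] Tour R x z K × y ∷ K ↭ L ++ M
glue {y = y} {L = L} {M} (l , π , p) (_ , stop , q) =
  L , (l , π , p) , ↭-trans (++-comm [ y ] L) (++⁺ˡ L q)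
glue {y = y} {L = L} {M} (l , π , p) (_ , _▸_ {l = m} r ρ , q) =
  l ++ m , (_ , path-join π r ρ , ↭-refl) , ↭-trans (↭-sym (shift y l m)) (++⁺ p q)

path-cut-last : ∀ {x y z l} → R x y → Path {V} R y z l → ∃[ w ] ∃[ k ] Path R x w k × R w z × z ∷ k ↭ x ∷ l
path-cut-last {x = x} r stop = x , [ x ] , stop , r , swap _ _ ↭-refl
path-cut-last {x = x} r (s ▸ π) with w , k , ρ , t , q ← path-cut-last s π =
  w , x ∷ k , r ▸ ρ , t , ↭-trans (swap _ _ ↭-refl) (prep x q)

cut-last : ∀ {x y L} → x ≢ y → Tour {V} R x y L → ∃[ w ] ∃[ K ] Tour R x w K × R w y × y ∷ K ↭ L
cut-last x≢y (_ , stop , p) = ⊥-elim (x≢y Eq.refl)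
cut-last x≢y (_ , r ▸ π , p) with w , k , ρ , s , q ← path-cut-last r π =
  w , k , (k , ρ , ↭-refl) , s , ↭-trans q p

tour-map : ∀ {S : W → W → Set} (f : V → W) → (∀ {a b} → R a b → S (f a) (f b)) →
           ∀ {x y L} → Tour R x y L → Tour S (f x) (f y) (map f L)
tour-map {R = R} {S = S} f mono (l , π , p) = map f l , go π , Perm.map⁺ f p
  where
  go : ∀ {x y l} → Path R x y l → Path S (f x) (f y) (map f l)
  go stop    = stop
  go (r ▸ π) = mono r ▸ go π

end∈ : ∀ {x y L} → Tour {V} R x y L → y ∈ L
end∈ (l , π , p) = ∈-resp-↭ p (go π)
  where
  go : ∀ {x y l} → Path {V} R x y l → y ∈ l
  go stop    = here Eq.refl
  go (_ ▸ π) = there (go π)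

start∈ : ∀ {x y L} → Tour {V} R x y L → x ∈ L
start∈ (_ , stop , p)  = ∈-resp-↭ p (here Eq.refl)
start∈ (_ , _ ▸ _ , p) = ∈-resp-↭ p (here Eq.refl)

TwoTours : {V : Set} → (V → V → Set) → (s₁ t₁ s₂ t₂ : V) → List V → Set
TwoTours R s₁ t₁ s₂ t₂ C = ∃[ L ] ∃[ M ] Tour R s₁ t₁ L × Tour R s₂ t₂ M × L ++ M ↭ C

two-map : ∀ {S : W → W → Set} (f : V → W) → (∀ {a b} → R a b → S (f a) (f b)) →
          ∀ {s₁ t₁ s₂ t₂ C} → TwoTours R s₁ t₁ s₂ t₂ C → TwoTours S (f s₁) (f t₁) (f s₂) (f t₂) (map f C)
two-map f mono (L , M , σ , τ , p) =
  map f L , map f M , tour-map f mono σ , tour-map f mono τ ,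
  subst (_↭ _) (List.map-++ f L M) (Perm.map⁺ f p)

two-swap : ∀ {s₁ t₁ s₂ t₂ C} → TwoTours {V} R s₁ t₁ s₂ t₂ C → TwoTours R s₂ t₂ s₁ t₁ C
two-swap (L , M , σ , τ , p) = M , L , τ , σ , ↭-trans (++-comm M L) p

TourWithout : {V : Set} → (V → V → Set) → (w u v : V) → List V → Set
TourWithout R w u v C = ∃[ L ] Tour R u v L × w ∷ L ↭ C

without-map : ∀ {S : W → W → Set} (f : V → W) → (∀ {a b} → R a b → S (f a) (f b)) →
              ∀ {w u v C} → TourWithout R w u v C → TourWithout S (f w) (f u) (f v) (map f C)
without-map f mono (L , σ , p) = map f L , tour-map f mono σ , Perm.map⁺ f p

-- The hypercube

Cube : ℕ → Set
Cube n = Vec Bool n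

data Flip : Cube n → Cube n → Set where
  here  : ∀ {b} {v : Cube n} → Flip (b ∷ v) (not b ∷ v)
  there : ∀ {b} {v w : Cube n} → Flip v w → Flip (b ∷ v) (b ∷ w)

flip-sym : {v w : Cube n} → Flip v w → Flip w v
flip-sym (here {b = b} {v}) = subst (λ c → Flip (not b ∷ v) (c ∷ v)) (Bool.not-involutive b) here
flip-sym (there r) = there (flip-sym r)

flip-insertAt : ∀ (i : Fin (suc n)) b {v w} → Flip v w → Flip (insertAt v i b) (insertAt w i b)
flip-insertAt zero    b r         = there r
flip-insertAt (suc i) b here      = here
flip-insertAt (suc i) b (there r) = there (flip-insertAt i b r)

flipAt : Fin n → Cube n → Cube n
flipAt i v = updateAt v i not

flip-flipAt : ∀ (i : Fin n) v → Flip v (flipAt i v)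
flip-flipAt zero    (b ∷ v) = here
flip-flipAt (suc i) (b ∷ v) = there (flip-flipAt i v)

flipAt-involutive : ∀ (i : Fin n) v → flipAt i (flipAt i v) ≡ v
flipAt-involutive zero    (b ∷ v) = cong (_∷ v) (Bool.not-involutive b)
flipAt-involutive (suc i) (b ∷ v) = cong (b ∷_) (flipAt-involutive i v)

parity : Cube n → Bool
parity []      = false
parity (b ∷ v) = b xor parity v

not-xorʳ : ∀ a b → a xor not b ≡ not (a xor b)
not-xorʳ false b = Eq.refl
not-xorʳ true  b = Eq.refl

not-xorˡ : ∀ a b → not a xor b ≡ not (a xor b)
not-xorˡ false b = Eq.refl
not-xorˡ true  b = Eq.sym (Bool.not-involutive b)

parity-flip : {v w : Cube n} → Flip v w → parity w ≡ not (parity v)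
parity-flip (here {b = b} {v}) = not-xorˡ b (parity v)
parity-flip (there {b = b} {v} r) = Eq.trans (cong (b xor_) (parity-flip r)) (not-xorʳ b (parity v))

parity-insertAt : ∀ (i : Fin (suc n)) b v → parity (insertAt v i b) ≡ b xor parity v
parity-insertAt zero    b v       = Eq.refl
parity-insertAt (suc i) b (c ∷ v) = begin
  c xor parity (insertAt v i b) ≡⟨ cong (c xor_) (parity-insertAt i b v) ⟩
  c xor (b xor parity v)        ≡⟨ Bool.xor-assoc c b _ ⟨
  (c xor b) xor parity v        ≡⟨ cong (_xor parity v) (Bool.xor-comm c b) ⟩
  (b xor c) xor parity v        ≡⟨ Bool.xor-assoc b c _ ⟩
  b xor (c xor parity v)        ∎
  where open ≡-Reasoning

cube : ∀ n → List (Cube n)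
cube zero    = [ [] ]
cube (suc n) = map (false ∷_) (cube n) ++ map (true ∷_) (cube n)

half : Fin (suc n) → Bool → List (Cube (suc n))
half i b = map (λ v → insertAt v i b) (cube _)

half-suc : ∀ (i : Fin (suc n)) b → half (suc i) b ≡ map (false ∷_) (half i b) ++ map (true ∷_) (half i b)
half-suc {n} i b = begin
  map (λ v → insertAt v (suc i) b) (map (false ∷_) (cube n) ++ map (true ∷_) (cube n))
    ≡⟨ List.map-++ _ (map (false ∷_) (cube n)) _ ⟩
  map (λ v → insertAt v (suc i) b) (map (false ∷_) (cube n)) ++ map (λ v → insertAt v (suc i) b) (map (true ∷_) (cube n))
    ≡⟨ cong₂ _++_ (swap-maps false) (swap-maps true) ⟩
  map (false ∷_) (half i b) ++ map (true ∷_) (half i b) ∎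
  where
  open ≡-Reasoning
  swap-maps : ∀ c → map (λ v → insertAt v (suc i) b) (map (c ∷_) (cube n)) ≡ map (c ∷_) (half i b)
  swap-maps c = Eq.trans (Eq.sym (List.map-∘ (cube n))) (List.map-∘ (cube n))

half-cover : ∀ (i : Fin (suc n)) b → half i b ++ half i (not b) ↭ cube (suc n)
half-cover zero false = ↭-refl
half-cover {n} zero true  = ++-comm (map (true ∷_) (cube n)) _
half-cover {suc n} (suc i) b = begin
  half (suc i) b ++ half (suc i) (not b)
    ≡⟨ cong₂ _++_ (half-suc i b) (half-suc i (not b)) ⟩
  (map (false ∷_) P ++ map (true ∷_) P) ++ map (false ∷_) Q ++ map (true ∷_) Q
    ↭⟨ solve 4 (λ a b c d → (a ⊕ b) ⊕ (c ⊕ d) ⊜ (a ⊕ c) ⊕ (b ⊕ d)) ↭-refl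
         (map (false ∷_) P) (map (true ∷_) P) (map (false ∷_) Q) (map (true ∷_) Q) ⟩
  (map (false ∷_) P ++ map (false ∷_) Q) ++ map (true ∷_) P ++ map (true ∷_) Q
    ≡⟨ cong₂ _++_ (List.map-++ (false ∷_) P Q) (List.map-++ (true ∷_) P Q) ⟨
  map (false ∷_) (P ++ Q) ++ map (true ∷_) (P ++ Q)
    ↭⟨ ++⁺ (Perm.map⁺ (false ∷_) (half-cover i b)) (Perm.map⁺ (true ∷_) (half-cover i b)) ⟩
  cube (suc (suc n)) ∎
  where
  open PermutationReasoning
  P = half i b
  Q = half i (not b)

-- Laceability properties and their transfer to half cubes

Laceable : ℕ → Set
Laceable n = ∀ (u v : Cube n) → parity v ≡ not (parity u) → Tour Flip u v (cube n)

-- Without `w` the opposite parity class is larger by one, so an alternating path through the rest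
-- has both ends in that class.
HyperLaceable : ℕ → Set
HyperLaceable n = ∀ (w u v : Cube n) → u ≢ v → parity v ≡ parity u → parity w ≡ not (parity u) →
                  TourWithout Flip w u v (cube n)

TwoLaceable : ℕ → Set
TwoLaceable n = ∀ (s₁ t₁ s₂ t₂ : Cube n) → s₁ ≢ s₂ → t₁ ≢ t₂ → parity s₂ ≡ parity s₁ →
                parity t₁ ≡ not (parity s₁) → parity t₂ ≡ not (parity s₁) →
                TwoTours Flip s₁ t₁ s₂ t₂ (cube n)

xor-cancelˡ : ∀ b {c d} → b xor c ≡ b xor d → c ≡ d
xor-cancelˡ false e = e
xor-cancelˡ true  e = Bool.not-injective e

parity-insertAt-≡ : ∀ (i : Fin (suc n)) b u v →
  parity (insertAt v i b) ≡ parity (insertAt u i b) → parity v ≡ parity u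
parity-insertAt-≡ i b u v e = xor-cancelˡ b
  (Eq.trans (Eq.sym (parity-insertAt i b v)) (Eq.trans e (parity-insertAt i b u)))

parity-insertAt-not : ∀ (i : Fin (suc n)) b u v →
  parity (insertAt v i b) ≡ not (parity (insertAt u i b)) → parity v ≡ not (parity u)
parity-insertAt-not i b u v e = xor-cancelˡ b
  (Eq.trans (Eq.sym (parity-insertAt i b v))
  (Eq.trans e (Eq.trans (cong not (parity-insertAt i b u)) (Eq.sym (not-xorʳ b (parity u))))))

-- Matching on this view turns a vertex of a half into a vertex of the smaller cube.
data InHalf (i : Fin (suc n)) (b : Bool) : Cube (suc n) → Set where
  ins : ∀ v → InHalf i b (insertAt v i b)

inHalf : ∀ (i : Fin (suc n)) {b} u → lookup u i ≡ b → InHalf i b u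
inHalf i u Eq.refl = subst (InHalf i (lookup u i)) (Vec.insertAt-removeAt u i) (ins (removeAt u i))

laceable-half : Laceable n → ∀ (i : Fin (suc n)) b u v → lookup u i ≡ b → lookup v i ≡ b →
                parity v ≡ not (parity u) → Tour Flip u v (half i b)
laceable-half lac i b u v ui vi e with inHalf i u ui | inHalf i v vi
... | ins u′ | ins v′ =
  tour-map (λ x → insertAt x i b) (flip-insertAt i b) (lac u′ v′ (parity-insertAt-not i b u′ v′ e))

hyperLaceable-half : HyperLaceable n → ∀ (i : Fin (suc n)) b w u v →
  lookup w i ≡ b → lookup u i ≡ b → lookup v i ≡ b →
  u ≢ v → parity v ≡ parity u → parity w ≡ not (parity u) → TourWithout Flip w u v (half i b)
hyperLaceable-half hyp i b w u v wi ui vi u≢v e e′ with inHalf i w wi | inHalf i u ui | inHalf i v vi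
... | ins w′ | ins u′ | ins v′ = without-map (λ x → insertAt x i b) (flip-insertAt i b)
  (hyp w′ u′ v′ (u≢v ∘ cong (λ x → insertAt x i b))
       (parity-insertAt-≡ i b u′ v′ e) (parity-insertAt-not i b u′ w′ e′))

twoLaceable-half : TwoLaceable n → ∀ (i : Fin (suc n)) b s₁ t₁ s₂ t₂ →
  lookup s₁ i ≡ b → lookup t₁ i ≡ b → lookup s₂ i ≡ b → lookup t₂ i ≡ b →
  s₁ ≢ s₂ → t₁ ≢ t₂ → parity s₂ ≡ parity s₁ →
  parity t₁ ≡ not (parity s₁) → parity t₂ ≡ not (parity s₁) → TwoTours Flip s₁ t₁ s₂ t₂ (half i b)
twoLaceable-half two i b s₁ t₁ s₂ t₂ e₁ e₂ e₃ e₄ s≢ t≢ p q r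
  with inHalf i s₁ e₁ | inHalf i t₁ e₂ | inHalf i s₂ e₃ | inHalf i t₂ e₄
... | ins a | ins b′ | ins c | ins d = two-map (λ x → insertAt x i b) (flip-insertAt i b)
  (two a b′ c d (s≢ ∘ cong (λ x → insertAt x i b)) (t≢ ∘ cong (λ x → insertAt x i b))
       (parity-insertAt-≡ i b a c p) (parity-insertAt-not i b a b′ q) (parity-insertAt-not i b a d r))

-- Hamiltonian paths of the hypercube

separate : ∀ (u v : Cube n) → u ≢ v → ∃[ i ] lookup v i ≡ not (lookup u i)
separate []      []      u≢v = ⊥-elim (u≢v Eq.refl)
separate (a ∷ u) (b ∷ v) u≢v with a Bool.≟ b
... | no a≢b = zero , Bool.¬-not (≢-sym a≢b)
... | yes Eq.refl with i , e ← separate u v (u≢v ∘ cong (a ∷_)) = suc i , e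

parity-≢ : ∀ (u v : Cube n) → parity v ≡ not (parity u) → u ≢ v
parity-≢ u v e Eq.refl = Bool.not-¬ Eq.refl e

bool-dichotomy : ∀ b c → c ≡ b ⊎ c ≡ not b
bool-dichotomy b c with c Bool.≟ b
... | yes e = inj₁ e
... | no ne = inj₂ (Bool.¬-not ne)

beside : ∀ (i : Fin (suc (suc n))) u → ∃[ w ] lookup w i ≡ lookup u i × parity w ≡ not (parity u)
beside zero    u@(_ ∷ _ ∷ _) = flipAt (suc zero) u , Eq.refl , parity-flip (flip-flipAt (suc zero) u)
beside (suc i) u@(_ ∷ _)     = flipAt zero u , Eq.refl , parity-flip (flip-flipAt zero u)

lookup-flipAt : ∀ (i : Fin n) u {b} → lookup u i ≡ b → lookup (flipAt i u) i ≡ not b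
lookup-flipAt i u e = Eq.trans (Vec.lookup∘updateAt i u) (cong not e)

parity-flipAt : ∀ (i : Fin n) u {b} → parity u ≡ b → parity (flipAt i u) ≡ not b
parity-flipAt i u e = Eq.trans (parity-flip (flip-flipAt i u)) (cong not e)

not² : ∀ {a b} → a ≡ not (not b) → a ≡ b
not² {b = b} e = Eq.trans e (Bool.not-involutive b)

-- Traverse the half of `u` up to some `w`, cross in a direction separating `u` from `v`, traverse
-- the other half. Crossing restores the parity of `u`, so any `w` of the opposite parity will do.
laceable-step : Laceable (suc n) → Laceable (suc (suc n))
laceable-step lac u v e with separate u v (parity-≢ u v e)
... | i , vi with beside i u
... | w , wi , e′ = tour-resp (half-cover i (lookup u i))
  (join (laceable-half lac i _ u w Eq.refl wi e′)
        (flip-flipAt i w)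
        (laceable-half lac i _ (flipAt i w) v (lookup-flipAt i w wi) vi
          (Eq.trans e (cong not (Eq.sym (not² (parity-flipAt i w e′)))))))

laceable : ∀ n → Laceable n
laceable zero [] [] ()
laceable (suc zero) (false ∷ []) (true ∷ []) _ = _ , here ▸ stop , ↭-refl
laceable (suc zero) (true ∷ []) (false ∷ []) _ = _ , here ▸ stop , swap _ _ ↭-refl
laceable (suc zero) (false ∷ []) (false ∷ []) ()
laceable (suc zero) (true ∷ []) (true ∷ []) ()
laceable (suc (suc n)) = laceable-step (laceable (suc n))

_≟_ : (u v : Cube n) → Dec (u ≡ v)
_≟_ = Vec.≡-dec Bool._≟_

-- Two paths covering the three-dimensional cube, by exhaustive search

flip? : (u v : Cube n) → Maybe (Flip u v)
flip? [] [] = nothing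
flip? (a ∷ u) (b ∷ v) with a Bool.≟ b
... | yes Eq.refl = Maybe.map there (flip? u v)
... | no a≢b with u ≟ v
...   | yes Eq.refl = just (subst (λ c → Flip (a ∷ u) (c ∷ u)) (Eq.sym (Bool.¬-not (≢-sym a≢b))) here)
...   | no _ = nothing

picks : {A : Set} (xs : List A) → List (∃[ x ] ∃[ ys ] x ∷ ys ↭ xs)
picks []       = []
picks (x ∷ xs) = (x , xs , ↭-refl) ∷
  map (λ (y , ys , p) → y , x ∷ ys , ↭-trans (swap y x ↭-refl) (prep x p)) (picks xs)

-- Backtracking search: `free` holds the unvisited vertices, `rest` those left for the other path.
-- Arrival at `y` ends the path, since it cannot visit its end twice.
paths : ℕ → (free : List (Cube n)) (x y : Cube n) →
        List (∃[ l ] ∃[ rest ] Path Flip x y l × l ++ rest ↭ x ∷ free)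
paths k free x y with x ≟ y
... | yes Eq.refl = [ [ x ] , free , stop , ↭-refl ]
paths zero    free x y | no _ = []
paths (suc k) free x y | no _ = concatMap (λ (z , ys , p) → extend z ys p (flip? x z)) (picks free)
  where
  extend : ∀ z ys → z ∷ ys ↭ free → Maybe (Flip x z) →
           List (∃[ l ] ∃[ rest ] Path Flip x y l × l ++ rest ↭ x ∷ free)
  extend z ys p nothing  = []
  extend z ys p (just r) =
    map (λ (l , rest , π , q) → x ∷ l , rest , r ▸ π , prep x (↭-trans q p)) (paths k ys z y)

-- The bound 7 on the number of steps makes the search exhaustive up to dimension 3.
find-two : (s₁ t₁ s₂ t₂ : Cube n) → Maybe (TwoTours Flip s₁ t₁ s₂ t₂ (cube n))
find-two {n} s₁ t₁ s₂ t₂ = head (concatMap first (picks (cube n)))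
  where
  Two = TwoTours Flip s₁ t₁ s₂ t₂ (cube n)
  third : ∀ {l} → Path Flip s₁ t₁ l → ∀ {rest} → l ++ rest ↭ cube n →
          ∃[ m ] ∃[ rest′ ] Path Flip s₂ t₂ m × m ++ rest′ ↭ rest → List Two
  third {l} π p (m , [] , ρ , q) = [ l , m , (l , π , ↭-refl) , (m , ρ , ↭-refl) ,
    ↭-trans (++⁺ˡ l (↭-trans (↭-reflexive (Eq.sym (List.++-identityʳ m))) q)) p ]
  -- Some vertex is left over, so this pair of paths does not cover the cube.
  third π p (m , _ ∷ _ , ρ , q) = []
  second : ∀ {l} → Path Flip s₁ t₁ l → ∀ {rest} → l ++ rest ↭ cube n → (∃[ x ] ∃[ ys ] x ∷ ys ↭ rest) → List Two
  second {l} π p (x , ys , q) with x ≟ s₂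
  ... | no _ = []
  ... | yes Eq.refl = concatMap (third π (↭-trans (++⁺ˡ l q) p)) (paths 7 ys s₂ t₂)
  first : (∃[ x ] ∃[ ys ] x ∷ ys ↭ cube n) → List Two
  first (x , ys , q) with x ≟ s₁
  ... | no _ = []
  ... | yes Eq.refl = concatMap (λ (l , rest , π , p) → concatMap (second π (↭-trans p q)) (picks rest)) (paths 7 ys s₁ t₁)

all-cube? : ∀ n {P : Cube n → Set} → (∀ v → Dec (P v)) → Dec (∀ v → P v)
all-cube? zero P? = map′ (λ { p [] → p }) (λ f → f []) (P? [])
all-cube? (suc n) P? = map′ (λ { (f , g) (false ∷ v) → f v ; (f , g) (true ∷ v) → g v })
  (λ f → (λ v → f (false ∷ v)) , (λ v → f (true ∷ v)))
  (all-cube? n (λ v → P? (false ∷ v)) ×-dec all-cube? n (λ v → P? (true ∷ v)))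

Admissible : (s₁ t₁ s₂ t₂ : Cube n) → Set
Admissible s₁ t₁ s₂ t₂ = s₁ ≢ s₂ × t₁ ≢ t₂ × parity s₂ ≡ parity s₁ ×
  parity t₁ ≡ not (parity s₁) × parity t₂ ≡ not (parity s₁)

search-succeeds? : ∀ n → Dec (∀ (s₁ t₁ s₂ t₂ : Cube n) → Admissible s₁ t₁ s₂ t₂ → is-just (find-two s₁ t₁ s₂ t₂) ≡ true)
search-succeeds? n = all-cube? n λ s₁ → all-cube? n λ t₁ → all-cube? n λ s₂ → all-cube? n λ t₂ →
  (¬? (s₁ ≟ s₂) ×-dec ¬? (t₁ ≟ t₂) ×-dec (parity s₂ Bool.≟ parity s₁) ×-dec
    (parity t₁ Bool.≟ not (parity s₁)) ×-dec (parity t₂ Bool.≟ not (parity s₁)))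
  →-dec (is-just (find-two s₁ t₁ s₂ t₂) Bool.≟ true)

from-search : {A : Set} (m : Maybe A) → is-just m ≡ true → A
from-search (just a) _ = a

-- The halves of this cube have only two vertices of each parity, too few for `pick`; hence the
-- induction starts here, by evaluating the search on all admissible quadruples.
twoLaceable-3 : TwoLaceable 3
twoLaceable-3 s₁ t₁ s₂ t₂ a b c d e =
  from-search (find-two s₁ t₁ s₂ t₂) (toWitness {a? = search-succeeds? 3} _ s₁ t₁ s₂ t₂ (a , b , c , d , e))

-- Leaving out a vertex, and two disjoint paths

swap-ends : ∀ {w u v : Cube n} {C} → TourWithout Flip w u v C → TourWithout Flip w v u C
swap-ends (L , σ , p) = L , reverse-tour flip-sym σ , p

-- The end `x` is left open and may be `u` itself. This admits a half that is a single edge, where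
-- the tour missing `w` is `u` alone, so one induction step serves the square and all larger cubes.
HalfWithout : ℕ → Set
HalfWithout n = ∀ (i : Fin (suc n)) b w u → lookup w i ≡ b → lookup u i ≡ b → parity w ≡ not (parity u) →
  ∃[ x ] lookup x i ≡ b × parity x ≡ parity u × TourWithout Flip w u x (half i b)

-- Here `w` lies in the half of `u`: avoid it there, cross from whatever end is reached, and cover
-- all of the other half.
half-without-continue : HalfWithout n → ∀ (i : Fin (suc n)) w u v →
  lookup w i ≡ lookup u i → parity w ≡ not (parity u) →
  lookup v i ≡ not (lookup u i) → parity v ≡ parity u → TourWithout Flip w u v (cube (suc n))
half-without-continue {n} start i w u v wi e′ vi e with start i _ w u wi Eq.refl e′
... | x , xi , ex , L , σ , p = L ++ half i _ ,
  join σ (flip-flipAt i x)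
    (laceable-half (laceable n) i _ (flipAt i x) v (lookup-flipAt i x xi) vi
      (Eq.trans e (Eq.sym (not² (cong not (parity-flipAt i x ex)))))) ,
  ↭-trans (++⁺ʳ _ p) (half-cover i _)

hyperLaceable-step : HalfWithout n → HyperLaceable (suc n)
hyperLaceable-step start w u v u≢v e e′ with separate u v u≢v
... | i , vi with bool-dichotomy (lookup u i) (lookup w i)
...   | inj₁ wi = half-without-continue start i w u v wi e′ vi e
-- With `w` in the half of `v`, the same construction starts from `v`.
...   | inj₂ wi = swap-ends (half-without-continue start i w v u
          (Eq.trans wi (Eq.sym vi)) (Eq.trans e′ (cong not (Eq.sym e)))
          (Eq.sym (not² (cong not vi))) (Eq.sym e))

half-without-1 : HalfWithout 1
half-without-1 i b w u wi ui e with inHalf i w wi | inHalf i u ui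
... | ins w′ | ins u′ = insertAt u′ i b , ui , Eq.refl ,
      without-map (λ x → insertAt x i b) (flip-insertAt i b)
        (line w′ u′ (parity-insertAt-not i b u′ w′ e))
  where
  line : ∀ (w u : Cube 1) → parity w ≡ not (parity u) → TourWithout Flip w u u (cube 1)
  line (false ∷ []) (true ∷ [])  _ = _ , (_ , stop , ↭-refl) , ↭-refl
  line (true ∷ [])  (false ∷ []) _ = _ , (_ , stop , ↭-refl) , swap _ _ ↭-refl

parity-flip-twice : ∀ (i j : Fin n) u → parity (flipAt i (flipAt j u)) ≡ parity u
parity-flip-twice i j u = not² (parity-flipAt i (flipAt j u) (parity-flipAt j u Eq.refl))

two-away : ∀ (i : Fin (suc (suc (suc n)))) u → ∃[ x ] lookup x i ≡ lookup u i × parity x ≡ parity u × u ≢ x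
two-away zero          u@(_ ∷ _ ∷ _) = flipAt (suc zero) (flipAt (suc (suc zero)) u) , Eq.refl ,
  parity-flip-twice (suc zero) (suc (suc zero)) u ,
  λ e → Bool.not-¬ Eq.refl (cong (λ x → lookup x (suc zero)) e)
two-away (suc zero)    u@(_ ∷ _ ∷ _) = flipAt zero (flipAt (suc (suc zero)) u) , Eq.refl ,
  parity-flip-twice zero (suc (suc zero)) u ,
  λ e → Bool.not-¬ Eq.refl (cong (λ x → lookup x zero) e)
two-away (suc (suc i)) u@(_ ∷ _ ∷ _) = flipAt zero (flipAt (suc zero) u) , Eq.refl ,
  parity-flip-twice zero (suc zero) u ,
  λ e → Bool.not-¬ Eq.refl (cong (λ x → lookup x zero) e)

half-without : HyperLaceable (suc (suc n)) → HalfWithout (suc (suc n))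
half-without hyp i b w u wi ui e with two-away i u
... | x , xi , ex , u≢x = x , Eq.trans xi ui , ex ,
      hyperLaceable-half hyp i b w u x wi ui (Eq.trans xi ui) u≢x ex e

hyperLaceable : ∀ n → HyperLaceable (suc (suc n))
hyperLaceable zero    = hyperLaceable-step half-without-1
hyperLaceable (suc n) = hyperLaceable-step (half-without (hyperLaceable n))

avoid-two : {A : Set} → (∀ (x y : A) → Dec (x ≡ y)) → ∀ {a b c : A} → a ≢ b → a ≢ c → b ≢ c →
            (P : A → Set) → P a → P b → P c → ∀ p q → ∃[ x ] P x × x ≢ p × x ≢ q
avoid-two _≟′_ {a} {b} {c} a≢b a≢c b≢c P pa pb pc p q with a ≟′ p | a ≟′ q
... | no a≢p | no a≢q = a , pa , a≢p , a≢q
... | yes Eq.refl | _ with b ≟′ q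
...   | no b≢q      = b , pb , ≢-sym a≢b , b≢q
...   | yes Eq.refl = c , pc , ≢-sym a≢c , ≢-sym b≢c
avoid-two _≟′_ {a} {b} {c} a≢b a≢c b≢c P pa pb pc p q | no _ | yes Eq.refl with b ≟′ p
...   | no b≢p      = b , pb , b≢p , ≢-sym a≢b
...   | yes Eq.refl = c , pc , ≢-sym b≢c , ≢-sym a≢c

parity-replicate : ∀ n → parity (replicate n false) ≡ false
parity-replicate zero    = Eq.refl
parity-replicate (suc n) = parity-replicate n

insertAt-injective : ∀ (i : Fin (suc n)) b {u v : Cube n} → insertAt u i b ≡ insertAt v i b → u ≡ v
insertAt-injective i b {u} {v} e =
  Eq.trans (Eq.sym (Vec.removeAt-insertAt u i b)) (Eq.trans (cong (λ x → removeAt x i) e) (Vec.removeAt-insertAt v i b))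

-- A half of dimension at least three contains three vertices of the given parity, and one of them
-- avoids both `p` and `q`.
pick : ∀ (i : Fin (suc (suc (suc (suc n))))) b c p q →
       ∃[ x ] (lookup x i ≡ b × parity x ≡ c) × x ≢ p × x ≢ q
pick {n} i b c p q = avoid-two _≟_
  (λ e → Bool.not-¬ Eq.refl (cong (λ x → lookup x zero) (insertAt-injective i b {x₁} {x₂} e)))
  (λ e → Bool.not-¬ Eq.refl (cong (λ x → lookup x zero) (insertAt-injective i b {x₁} {x₃} e)))
  (λ e → contradiction (cong (λ x → lookup x (suc zero)) (insertAt-injective i b {x₂} {x₃} e)) λ ())
  (λ x → lookup x i ≡ b × parity x ≡ c)
  (Vec.insertAt-lookup x₁ i b , lift x₁ (cong (d xor_) (parity-replicate n)))
  (Vec.insertAt-lookup x₂ i b , lift x₂ (Eq.trans (cong (λ z → not d xor not z) (parity-replicate n)) (twist d)))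
  (Vec.insertAt-lookup x₃ i b , lift x₃ (Eq.trans (cong (λ z → not d xor not z) (parity-replicate n)) (twist d)))
  p q
  where
  -- The parity that a word must have before the bit `b` is inserted; all three candidates have it.
  d = b xor c
  x₁ x₂ x₃ : Cube (suc (suc (suc n)))
  x₁ = d ∷ false ∷ false ∷ replicate n false
  x₂ = not d ∷ true ∷ false ∷ replicate n false
  x₃ = not d ∷ false ∷ true ∷ replicate n false
  twist : ∀ d → not d xor true ≡ d xor false
  twist false = Eq.refl
  twist true  = Eq.refl
  undo : ∀ b c → b xor ((b xor c) xor false) ≡ c
  undo false false = Eq.refl
  undo false true = Eq.refl
  undo true false = Eq.refl
  undo true true = Eq.refl
  lift : ∀ x → parity x ≡ d xor false → parity (insertAt x i b) ≡ c
  lift x e = Eq.trans (parity-insertAt i b x) (Eq.trans (cong (b xor_) e) (undo b c))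

flipAt-≢ : ∀ (i : Fin n) x y → x ≢ flipAt i y → flipAt i x ≢ y
flipAt-≢ i x y ne e = ne (Eq.trans (Eq.sym (flipAt-involutive i x)) (cong (flipAt i) e))

-- s₁, t₁ and t₂ lie in one half: leave it towards s₂ through an arbitrary vertex x.
twoLaceable-three : TwoLaceable (suc (suc (suc n))) → ∀ (i : Fin (suc (suc (suc (suc n))))) s₁ t₁ s₂ t₂ →
  lookup s₂ i ≡ not (lookup s₁ i) → lookup t₁ i ≡ lookup s₁ i → lookup t₂ i ≡ lookup s₁ i →
  t₁ ≢ t₂ → parity s₂ ≡ parity s₁ → parity t₁ ≡ not (parity s₁) → parity t₂ ≡ not (parity s₁) →
  TwoTours Flip s₁ t₁ s₂ t₂ (cube _)
twoLaceable-three two i s₁ t₁ s₂ t₂ hs₂ ht₁ ht₂ t≢ es e₁ e₂ with two-away i s₁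
... | x , xi , ex , s≢x with twoLaceable-half two i _ s₁ t₁ x t₂ Eq.refl ht₁ xi ht₂ s≢x t≢ ex e₁ e₂
... | L , M , σ , τ , p = L , half i _ ++ M , σ ,
  join (laceable-half (laceable _) i _ s₂ (flipAt i x) hs₂ (lookup-flipAt i x xi)
          (parity-flipAt i x (Eq.trans ex (Eq.sym es))))
       (flip-sym (flip-flipAt i x)) τ ,
  ↭-trans (solve 3 (λ l h m → l ⊕ (h ⊕ m) ⊜ (l ⊕ m) ⊕ h) ↭-refl L (half i _) M)
    (↭-trans (++⁺ʳ _ p) (half-cover i _))

twoLaceable-step : TwoLaceable (suc (suc (suc n))) → TwoLaceable (suc (suc (suc (suc n))))
twoLaceable-step two s₁ t₁ s₂ t₂ s≢ t≢ es e₁ e₂ with separate s₁ s₂ s≢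
... | i , hs₂ with bool-dichotomy (lookup s₁ i) (lookup t₁ i) | bool-dichotomy (lookup s₁ i) (lookup t₂ i)
...   | inj₁ h₁ | inj₁ h₂ = twoLaceable-three two i s₁ t₁ s₂ t₂ hs₂ h₁ h₂ t≢ es e₁ e₂
...   | inj₂ h₁ | inj₂ h₂ = two-swap (twoLaceable-three two i s₂ t₂ s₁ t₁
          (Eq.sym (not² (cong not hs₂))) (Eq.trans h₂ (Eq.sym hs₂)) (Eq.trans h₁ (Eq.sym hs₂))
          (≢-sym t≢) (Eq.sym es) (Eq.trans e₂ (cong not (Eq.sym es))) (Eq.trans e₁ (cong not (Eq.sym es))))
...   | inj₁ h₁ | inj₂ h₂ = half i _ , half i _ ,
          laceable-half (laceable _) i _ s₁ t₁ Eq.refl h₁ e₁ ,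
          laceable-half (laceable _) i _ s₂ t₂ hs₂ h₂ (Eq.trans e₂ (cong not (Eq.sym es))) ,
          half-cover i _
-- Both tours must cross, in opposite directions: the first through `x`, the second through `y`. The
-- vertices avoided keep the two sources distinct, and the two sinks, in each half.
...   | inj₂ h₁ | inj₁ h₂
  with pick i (lookup s₁ i) (not (parity s₁)) t₂ (flipAt i s₂) | pick i (lookup s₁ i) (parity s₁) s₁ (flipAt i t₁)
... | x , (xi , ex) , x≢t₂ , x≢s₂ | y , (yi , ey) , y≢s₁ , y≢t₁
  with twoLaceable-half two i _ s₁ x y t₂ Eq.refl xi yi h₂ (≢-sym y≢s₁) x≢t₂ ey ex e₂
     | twoLaceable-half two i _ (flipAt i x) t₁ s₂ (flipAt i y) (lookup-flipAt i x xi) h₁ hs₂ (lookup-flipAt i y yi)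
         (flipAt-≢ i x s₂ x≢s₂) (≢-sym (flipAt-≢ i y t₁ y≢t₁))
         (Eq.trans es (Eq.sym (not² (parity-flipAt i x ex))))
         (Eq.trans e₁ (cong not (Eq.sym (not² (parity-flipAt i x ex)))))
         (Eq.trans (parity-flipAt i y ey) (cong not (Eq.sym (not² (parity-flipAt i x ex)))))
... | L , M , σ , τ , p | L′ , M′ , σ′ , τ′ , p′ = L ++ L′ , M′ ++ M ,
  join σ (flip-flipAt i x) σ′ , join τ′ (flip-sym (flip-flipAt i y)) τ ,
  ↭-trans (solve 4 (λ a b c d → (a ⊕ b) ⊕ (c ⊕ d) ⊜ (a ⊕ d) ⊕ (b ⊕ c)) ↭-refl L L′ M′ M)
    (↭-trans (++⁺ p p′) (half-cover i _))

twoLaceable : ∀ n → TwoLaceable (suc (suc (suc n)))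
twoLaceable zero    = twoLaceable-3
twoLaceable (suc n) = twoLaceable-step (twoLaceable n)

-- Poles of the hypercube and their neighbours

pole : Bool → Cube n
pole b = replicate _ b

near : Fin n → Bool → Cube n
near i b = flipAt i (pole b)

lookup-near : ∀ (i : Fin n) b → lookup (near i b) i ≡ not b
lookup-near i b = lookup-flipAt i (pole b) (Vec.lookup-replicate i b)

lookup-near-≢ : ∀ {i j : Fin n} b → i ≢ j → lookup (near i b) j ≡ b
lookup-near-≢ {i = i} {j} b i≢j =
  Eq.trans (Vec.lookup∘updateAt′ j i (≢-sym i≢j) (pole b)) (Vec.lookup-replicate j b)

parity-near : ∀ (i : Fin n) b {c} → parity (pole {n} b) ≡ c → parity (near i b) ≡ not c
parity-near i b e = parity-flipAt i (pole b) e

flip-to-pole : ∀ b {w p : Cube n} → Flip w p → p ≡ pole b → ∃[ i ] w ≡ near i b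
flip-to-pole b (here {b = c}) Eq.refl = zero , cong (_∷ pole (not c)) (Eq.sym (Bool.not-involutive c))
flip-to-pole b (there r) e
  with Eq.refl ← Vec.∷-injectiveˡ e with i , Eq.refl ← flip-to-pole b r (Vec.∷-injectiveʳ e) = suc i , Eq.refl

separated : ∀ (i : Fin n) {u v : Cube n} b → lookup u i ≡ b → lookup v i ≡ not b → u ≢ v
separated i b ui vi Eq.refl = Bool.not-¬ Eq.refl (Eq.trans (Eq.sym ui) vi)

pole-≢ : ∀ b → pole {suc n} b ≢ pole (not b)
pole-≢ b = separated zero b Eq.refl Eq.refl

near-injective : ∀ (i j : Fin n) b → i ≢ j → near i b ≢ near j b
near-injective i j b i≢j =
  ≢-sym (separated i b (lookup-near-≢ b (≢-sym i≢j)) (lookup-near i b))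

third : ∀ (i j : Fin (suc (suc (suc n)))) → ∃[ k ] k ≢ i × k ≢ j
third i j with avoid-two Fin._≟_ {zero} {suc zero} {suc (suc zero)} (λ ()) (λ ()) (λ ()) (λ _ → ⊤) _ _ _ i j
... | k , _ , k≢i , k≢j = k , k≢i , k≢j

near-≢-pole : ∀ (i : Fin (suc (suc (suc n)))) b → near i b ≢ pole (not b)
near-≢-pole i b with k , k≢i , _ ← third i i =
  separated k b (lookup-near-≢ b (≢-sym k≢i)) (Vec.lookup-replicate k (not b))

near-≢-near : ∀ (i j : Fin (suc (suc (suc n)))) b → near i b ≢ near j (not b)
near-≢-near i j b with k , k≢i , k≢j ← third i j =
  separated k b (lookup-near-≢ b (≢-sym k≢i)) (lookup-near-≢ (not b) (≢-sym k≢j))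

near-avoiding : ∀ b (p q : Cube (suc (suc (suc n)))) → ∃[ i ] near i b ≢ p × near i b ≢ q
near-avoiding b p q with avoid-two _≟_
    {near zero b} {near (suc zero) b} {near (suc (suc zero)) b}
    (near-injective zero (suc zero) b λ ()) (near-injective zero (suc (suc zero)) b λ ())
    (near-injective (suc zero) (suc (suc zero)) b λ ())
    (λ x → ∃[ i ] x ≡ near i b) (zero , Eq.refl) (suc zero , Eq.refl) (suc (suc zero) , Eq.refl) p q
... | _ , (i , Eq.refl) , ≢p , ≢q = i , ≢p , ≢q

cube-unique : ∀ n → Unique (cube n)
cube-unique zero    = All.[] ∷ []
cube-unique (suc n) = Unique.++⁺
  (Unique.map⁺ Vec.∷-injectiveʳ (cube-unique n)) (Unique.map⁺ Vec.∷-injectiveʳ (cube-unique n)) disjoint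
  where
  disjoint : ∀ {v} → v ∈ map (false ∷_) (cube n) × v ∈ map (true ∷_) (cube n) → ⊥
  disjoint (p , q) with ∈-map⁻ (false ∷_) p | ∈-map⁻ (true ∷_) q
  ... | _ , _ , Eq.refl | _ , _ , ()

unique-++-disjoint : ∀ {A : Set} (L : List A) {M x y} → Unique (L ++ M) → x ∈ L → y ∈ M → x ≢ y
unique-++-disjoint (x ∷ L) (px ∷ _) (here Eq.refl) y∈M = All.lookup px (∈-++⁺ʳ L y∈M)
unique-++-disjoint (x ∷ L) (_ ∷ U)  (there x∈L)    y∈M = unique-++-disjoint L U x∈L y∈M

Unique-resp-↭ : ∀ {A : Set} {L M : List A} → L ↭ M → Unique L → Unique M
Unique-resp-↭ {A} p = SetoidPerm.Unique-resp-↭ (setoid A) (↭⇒↭ₛ p)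

-- Cut the end off a covering tour that leads to a pole: it then ends next to the pole.
two-cut : ∀ b (s₁ s₂ t₂ : Cube (suc (suc (suc n)))) → s₁ ≢ s₂ → pole b ≢ t₂ → parity s₂ ≡ parity s₁ →
          parity (pole {suc (suc (suc n))} b) ≡ not (parity s₁) → parity t₂ ≡ not (parity s₁) →
          ∃[ i ] near i b ≢ s₂ × ∃[ L ] ∃[ M ]
            Tour Flip s₁ (near i b) L × Tour Flip s₂ t₂ M × pole b ∷ L ++ M ↭ cube _
two-cut b s₁ s₂ t₂ s≢ t≢ es e₁ e₂ with twoLaceable _ s₁ (pole b) s₂ t₂ s≢ t≢ es e₁ e₂
... | L , M , σ , τ , p with cut-last (parity-≢ s₁ (pole b) e₁) σ
...   | w , K , σ′ , r , q with flip-to-pole b r Eq.refl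
...     | i , Eq.refl = i ,
  -- The two tours together list every vertex of the cube once, so they are disjoint.
  unique-++-disjoint L (Unique-resp-↭ (↭-sym p) (cube-unique _)) (∈-resp-↭ q (there (end∈ σ′))) (start∈ τ) ,
  K , M , σ′ , τ , ↭-trans (++⁺ʳ M q) p

-- Two hypercubes glued at their poles

module Glued {m : ℕ} {V : Set} (_~_ : V → V → Set) (~-sym : ∀ {x y} → x ~ y → y ~ x) (P : Bool → V) where

  private
    n′ : ℕ
    n′ = suc (suc (suc m))

    C : Set
    C = Cube n′

  record Side (h : C → V) : Set where
    field
      edge : ∀ {u v} → Flip u v → h u ~ h v
      at-pole : ∀ b → h (pole b) ≡ P b

    whole : List V
    whole = map h (cube n′)

    part : Fin n′ → Bool → List V
    part i b = map h (half i b)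

    parts : ∀ i b → part i b ++ part i (not b) ↭ whole
    parts i b = ↭-trans (↭-reflexive (Eq.sym (List.map-++ h (half i b) (half i (not b)))))
                        (Perm.map⁺ h (half-cover i b))

    -- The ends are named up to equality, so that a pole reads `P b` in either cube and tours of
    -- different cubes can be glued there.
    tour : ∀ u v {x y} → h u ≡ x → h v ≡ y → parity v ≡ not (parity u) → Tour _~_ x y whole
    tour u v Eq.refl Eq.refl e = tour-map h edge (laceable n′ u v e)

    tour-part : ∀ i b u v {x y} → h u ≡ x → h v ≡ y → lookup u i ≡ b → lookup v i ≡ b →
                parity v ≡ not (parity u) → Tour _~_ x y (part i b)
    tour-part i b u v Eq.refl Eq.refl ui vi e =
      tour-map h edge (laceable-half (laceable (suc (suc m))) i b u v ui vi e)

    without : ∀ w u v {z x y} → h w ≡ z → h u ≡ x → h v ≡ y → u ≢ v → parity v ≡ parity u →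
              parity w ≡ not (parity u) → TourWithout _~_ z x y whole
    without w u v Eq.refl Eq.refl Eq.refl ne e e′ =
      without-map h edge (hyperLaceable (suc m) w u v ne e e′)

    without-part : ∀ i b w u v {z x y} → h w ≡ z → h u ≡ x → h v ≡ y →
                   lookup w i ≡ b → lookup u i ≡ b → lookup v i ≡ b → u ≢ v → parity v ≡ parity u →
                   parity w ≡ not (parity u) → TourWithout _~_ z x y (part i b)
    without-part i b w u v Eq.refl Eq.refl Eq.refl wi ui vi ne e e′ =
      without-map h edge (hyperLaceable-half (hyperLaceable m) i b w u v wi ui vi ne e e′)

    two : ∀ s₁ t₁ s₂ t₂ {x₁ y₁ x₂ y₂} → h s₁ ≡ x₁ → h t₁ ≡ y₁ → h s₂ ≡ x₂ → h t₂ ≡ y₂ →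
          s₁ ≢ s₂ → t₁ ≢ t₂ → parity s₂ ≡ parity s₁ → parity t₁ ≡ not (parity s₁) → parity t₂ ≡ not (parity s₁) →
          TwoTours _~_ x₁ y₁ x₂ y₂ whole
    two s₁ t₁ s₂ t₂ Eq.refl Eq.refl Eq.refl Eq.refl s≢ t≢ es e₁ e₂ =
      two-map h edge (twoLaceable m s₁ t₁ s₂ t₂ s≢ t≢ es e₁ e₂)

    two-part : TwoLaceable (suc (suc m)) → ∀ i b s₁ t₁ s₂ t₂ {x₁ y₁ x₂ y₂} →
      h s₁ ≡ x₁ → h t₁ ≡ y₁ → h s₂ ≡ x₂ → h t₂ ≡ y₂ →
      lookup s₁ i ≡ b → lookup t₁ i ≡ b → lookup s₂ i ≡ b → lookup t₂ i ≡ b →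
      s₁ ≢ s₂ → t₁ ≢ t₂ → parity s₂ ≡ parity s₁ → parity t₁ ≡ not (parity s₁) → parity t₂ ≡ not (parity s₁) →
      TwoTours _~_ x₁ y₁ x₂ y₂ (part i b)
    two-part lac i b s₁ t₁ s₂ t₂ Eq.refl Eq.refl Eq.refl Eq.refl i₁ j₁ i₂ j₂ s≢ t≢ es e₁ e₂ =
      two-map h edge (twoLaceable-half lac i b s₁ t₁ s₂ t₂ i₁ j₁ i₂ j₂ s≢ t≢ es e₁ e₂)

    two-cut-pole : ∀ b s₁ s₂ t₂ {y₂} → h t₂ ≡ y₂ → s₁ ≢ s₂ → pole b ≢ t₂ → parity s₂ ≡ parity s₁ →
      parity (pole {n′} b) ≡ not (parity s₁) → parity t₂ ≡ not (parity s₁) →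
      ∃[ i ] near i b ≢ s₂ × ∃[ L ] ∃[ M ]
        Tour _~_ (h s₁) (h (near i b)) L × Tour _~_ (h s₂) y₂ M × P b ∷ L ++ M ↭ whole
    two-cut-pole b s₁ s₂ t₂ Eq.refl s≢ t≢ es e₁ e₂ with two-cut b s₁ s₂ t₂ s≢ t≢ es e₁ e₂
    ... | i , ne , L , M , σ , τ , p = i , ne , map h L , map h M , tour-map h edge σ , tour-map h edge τ ,
      ↭-trans (↭-reflexive (cong₂ _∷_ (Eq.sym (at-pole b)) (Eq.sym (List.map-++ h L M)))) (Perm.map⁺ h p)

  record TwoCubes (f g : C → V) : Set where
    field
      F : Side f
      G : Side g
      bridge : ∀ i b → f (near i b) ~ g (near i b)

  flip-sides : ∀ {f g} → TwoCubes f g → TwoCubes g f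
  flip-sides H = record { F = G ; G = F ; bridge = λ i b → ~-sym (bridge i b) }
    where open TwoCubes H

  -- The images of the two cubes together list each pole twice; with one copy of each set apart, `K`
  -- counts it once.
  Spanning : (f g : C → V) → V → V → Set
  Spanning f g x y = ∃[ K ] Tour _~_ x y K × P false ∷ P true ∷ K ↭ map f (cube n′) ++ map g (cube n′)

  module _ {f g : C → V} where

    spanning : ∀ b {x y K} → Tour _~_ x y K → P b ∷ P (not b) ∷ K ↭ map f (cube n′) ++ map g (cube n′) →
               Spanning f g x y
    spanning false σ p = _ , σ , p
    spanning true  σ p = _ , σ , ↭-trans (swap _ _ ↭-refl) p

    spanning-sym : ∀ {x y} → Spanning f g x y → Spanning f g y x
    spanning-sym (K , σ , p) = K , reverse-tour ~-sym σ , p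

    spanning-flip : ∀ {x y} → Spanning f g x y → Spanning g f x y
    spanning-flip (K , σ , p) = K , σ , ↭-trans p (++-comm (map f (cube n′)) _)

  module Sides {f g : C → V} (H : TwoCubes f g) where
    open TwoCubes H
    private
      module F = Side F
      module G = Side G
      rev : ∀ {x y L} → Tour _~_ x y L → Tour _~_ y x L
      rev = reverse-tour ~-sym

    poles-agree : ∀ b → f (pole b) ≡ g (pole b)
    poles-agree b = Eq.trans (F.at-pole b) (Eq.sym (G.at-pole b))

    -- Odd dimension: the poles have different parity

    module Odd (odd : ∀ b → parity (pole {n′} b) ≡ b) where

      -- Go from `u` to `a`, over the bridge, through the second cube to `p`, and back in the first
      -- cube to `v`. The second cube omits `q`, which the first one covers.
      same-side-same-parity : ∀ u v → u ≢ v → parity v ≡ parity u → Spanning f g (f u) (f v)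
      same-side-same-parity u v u≢v e
        with F.two u a v p Eq.refl Eq.refl Eq.refl (F.at-pole _) u≢v (near-≢-pole zero b) e ea (odd _)
           | G.without q a p (G.at-pole _) Eq.refl (G.at-pole _) (near-≢-pole zero b)
               (Eq.trans (odd _) (Eq.sym ea)) (Eq.trans (odd _) (Eq.sym (not² (cong not ea))))
        where
        b = parity u
        p q a : C
        p = pole (not b)
        q = pole b
        a = near zero b
        ea = parity-near {n′} zero b (odd b)
      ... | L , M , σ , τ , c | N , ρ , d with glue (join σ (bridge zero _) ρ) (rev τ)
      ...   | K , κ , k = spanning (parity u) κ
        (↭-trans (prep _ k)
        (↭-trans (solve 4 (λ q l n m → q ⊕ ((l ⊕ n) ⊕ m) ⊜ (l ⊕ m) ⊕ (q ⊕ n)) ↭-refl [ P (parity u) ] L N M)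
                 (++⁺ c d)))

      opposite : ∀ b → parity (pole {n′} (not b)) ≡ not (parity (pole {n′} b))
      opposite b = Eq.trans (odd _) (cong not (Eq.sym (odd b)))

      opposite′ : ∀ b → parity (pole {n′} b) ≡ not (parity (pole {n′} (not b)))
      opposite′ b = Eq.sym (not² (cong not (opposite b)))

      -- Go from `u` to a pole, through the whole second cube to the other pole, and on to `v`. If
      -- one end is the pole of its own parity, its leg is empty and the other leg omits that pole;
      -- if both are, both legs vanish and only `polar` helps.
      same-side-opposite-parity : Spanning f g (P false) (P true) →
        ∀ u v → parity v ≡ not (parity u) → Spanning f g (f u) (f v)
      same-side-opposite-parity polar u v e with u ≟ pole (parity u) | v ≟ pole (not (parity u))
      ... | no u≢ | no v≢
        with F.two u (pole (not b)) (pole b) v Eq.refl (F.at-pole _) (F.at-pole _) Eq.refl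
               u≢ (≢-sym v≢) (odd b) (odd _) e
        where b = parity u
      ... | L , M , σ , τ , c with glue σ (G.tour (pole (not b)) (pole b) (G.at-pole _) (G.at-pole _) (opposite′ b))
        where b = parity u
      ...   | K₁ , κ₁ , k₁ with glue κ₁ τ
      ...     | K , κ , k = spanning (parity u) κ
        (↭-trans (swap _ _ ↭-refl)
        (↭-trans (prep _ k)
        (↭-trans (++⁺ʳ M k₁)
        (↭-trans (solve 3 (λ l n m → (l ⊕ n) ⊕ m ⊜ (l ⊕ m) ⊕ n) ↭-refl L G.whole M)
                 (++⁺ʳ _ c)))))
      same-side-opposite-parity polar u v e | yes u≡ | no v≢
        with F.without (pole b) (pole (not b)) v (F.at-pole _) (F.at-pole _) Eq.refl
               (≢-sym v≢) (Eq.trans e (Eq.sym (odd _))) (opposite′ b)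
        where b = parity u
      ... | L , σ , c with glue (G.tour (pole b) (pole (not b)) pb (G.at-pole _) (opposite b)) σ
        where
        b = parity u
        pb : g (pole b) ≡ f u
        pb = Eq.trans (G.at-pole b) (Eq.trans (Eq.sym (F.at-pole b)) (cong f (Eq.sym u≡)))
      ...   | K , κ , k = spanning (parity u) κ
        (↭-trans (prep _ k)
        (↭-trans (solve 3 (λ p n l → p ⊕ (n ⊕ l) ⊜ (p ⊕ l) ⊕ n) ↭-refl [ P (parity u) ] G.whole L)
                 (++⁺ʳ _ c)))
      same-side-opposite-parity polar u v e | no u≢ | yes v≡
        with F.without (pole (not b)) u (pole b) (F.at-pole _) Eq.refl (F.at-pole _) u≢ (odd b) (odd _)
        where b = parity u
      ... | L , σ , c with glue σ (G.tour (pole b) (pole (not b)) (G.at-pole _) pv (opposite b))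
        where
        b = parity u
        pv : g (pole (not b)) ≡ f v
        pv = Eq.trans (G.at-pole _) (Eq.trans (Eq.sym (F.at-pole _)) (cong f (Eq.sym v≡)))
      ...   | K , κ , k = spanning (parity u) κ
        (↭-trans (swap _ _ ↭-refl)
        (↭-trans (prep _ k) (++⁺ʳ _ c)))
      same-side-opposite-parity polar u v e | yes u≡ | yes v≡ = subst₂ (Spanning f g)
        (Eq.trans (Eq.sym (F.at-pole _)) (cong f (Eq.sym u≡)))
        (Eq.trans (Eq.sym (F.at-pole _)) (cong f (Eq.sym v≡)))
        (oriented (parity u))
        where
        oriented : ∀ b → Spanning f g (P b) (P (not b))
        oriented false = polar
        oriented true  = spanning-sym polar

      -- Cross at the pole with the parity of `v`; the other pole is covered in the first cube and
      -- omitted in the second.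
      across-opposite-parity : ∀ u v → parity v ≡ not (parity u) → v ≢ pole (parity v) → Spanning f g (f u) (g v)
      across-opposite-parity u v e v≢
        with G.without (pole (not b)) (pole b) v (G.at-pole _) (G.at-pole _) Eq.refl
               (≢-sym v≢) (Eq.sym (odd b)) (opposite b)
        where b = parity v
      ... | N , ρ , d with glue (F.tour u (pole (parity v)) Eq.refl (F.at-pole _) (Eq.trans (odd _) e)) ρ
      ...   | K , κ , k = spanning (parity v) κ
        (↭-trans (swap _ _ ↭-refl)
        (↭-trans (prep _ k)
        (↭-trans (solve 3 (λ p l n → p ⊕ (l ⊕ n) ⊜ l ⊕ (p ⊕ n)) ↭-refl [ P (not (parity v)) ] F.whole N)
                 (++⁺ˡ _ d))))

      -- Each cube is visited twice: from `u` to `p`, through the second cube to `q`, in the first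
      -- cube to `a`, then over the bridge and on to `v`.
      across-same-parity : ∀ u v → parity v ≡ parity u → u ≢ pole (parity u) → v ≢ pole (parity u) →
                           Spanning f g (f u) (g v)
      across-same-parity u v e u≢ v≢
        with F.two u p q a Eq.refl (F.at-pole _) (F.at-pole _) Eq.refl
               u≢ (≢-sym (near-≢-pole zero b)) (odd _) (odd _) ea
           | G.two q p v a (G.at-pole _) (G.at-pole _) Eq.refl Eq.refl
               (≢-sym v≢) (≢-sym (near-≢-pole zero b)) (Eq.trans e (Eq.sym (odd b))) (opposite b)
               (Eq.trans ea (cong not (Eq.sym (odd b))))
        where
        b = parity u
        p q a : C
        p = pole (not b)
        q = pole b
        a = near zero b
        ea = parity-near {n′} zero b (odd b)
      ... | L , M , σ , τ , c | L′ , M′ , σ′ , τ′ , c′ with glue σ (rev σ′)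
      ...   | K₁ , κ₁ , k₁ with glue κ₁ (join τ (bridge zero _) (rev τ′))
      ...     | K , κ , k = spanning (parity u) κ
        (↭-trans (swap _ _ ↭-refl)
        (↭-trans (prep _ k)
        (↭-trans (++⁺ʳ (M ++ M′) k₁)
        (↭-trans (solve 4 (λ l l′ m m′ → (l ⊕ l′) ⊕ (m ⊕ m′) ⊜ (l ⊕ m) ⊕ (l′ ⊕ m′)) ↭-refl L L′ M M′)
                 (++⁺ c c′)))))

    -- Even dimension: both poles are even

    module Even (even : ∀ b → parity (pole {n′} b) ≡ false) where

      private
        odd-near : ∀ i b → parity (near {n′} i b) ≡ true
        odd-near i b = parity-near i b (even b)

        opposite-odd : ∀ b {c} → c ≡ true → parity (pole {n′} b) ≡ not c
        opposite-odd b e = Eq.trans (even b) (cong not (Eq.sym e))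

      -- Each cube omits one pole and covers the one that the other omits.
      across-odd-odd : ∀ u v → parity u ≡ true → parity v ≡ true → Spanning f g (f u) (g v)
      across-odd-odd u v eu ev with near-avoiding false u v
      ... | i , a≢u , a≢v
        with F.without (pole false) u a (F.at-pole _) Eq.refl Eq.refl (≢-sym a≢u)
               (Eq.trans ea (Eq.sym eu)) (opposite-odd false eu)
           | G.without (pole true) a v (G.at-pole _) Eq.refl Eq.refl a≢v
               (Eq.trans ev (Eq.sym ea)) (opposite-odd true ea)
        where
        a : C
        a = near i false
        ea = odd-near i false
      ... | L , σ , c | M , τ , d = spanning false (join σ (bridge i false) τ)
        (↭-trans (solve 4 (λ p q l m → p ⊕ (q ⊕ (l ⊕ m)) ⊜ (p ⊕ l) ⊕ (q ⊕ m)) ↭-refl [ P false ] [ P true ] L M)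
                 (++⁺ c d))

      -- The tour from `u` stops just before `pole true` and takes the bridge; the second cube
      -- covers that pole and leads to `pole false`, whence the first cube is completed up to `v`.
      same-side-odd-odd : ∀ u v → u ≢ v → parity u ≡ true → parity v ≡ true → Spanning f g (f u) (f v)
      same-side-odd-odd u v u≢v eu ev
        with F.two-cut-pole true u v (pole false) (F.at-pole _) u≢v (pole-≢ true)
               (Eq.trans ev (Eq.sym eu)) (opposite-odd true eu) (opposite-odd false eu)
      ... | i , _ , L , M , σ , τ , c
        with glue (join σ (bridge i true)
               (G.tour (near i true) (pole false) Eq.refl (G.at-pole _) (opposite-odd false (odd-near i true))))
               (rev τ)
      ...   | K , κ , k = spanning true κ
        (↭-trans (prep _ k)
        (↭-trans (solve 4 (λ p l n m → p ⊕ ((l ⊕ n) ⊕ m) ⊜ (p ⊕ (l ⊕ m)) ⊕ n) ↭-refl [ P true ] L G.whole M)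
                 (++⁺ʳ _ c)))

      -- Each cube is visited twice: from `u` to `pole false`, in the second cube to `near k false`,
      -- over a bridge and through the first cube to `near i true`, over a bridge and on to `v`.
      across-odd-even : ∀ u v → parity u ≡ true → parity v ≡ false → v ≢ pole false → Spanning f g (f u) (g v)
      across-odd-even u v eu ev v≢ with near-avoiding false u u
      ... | k , a≢u , _
        with F.two-cut-pole true (near k false) u (pole false) (F.at-pole _) a≢u (pole-≢ true)
               (Eq.trans eu (Eq.sym (odd-near k false)))
               (opposite-odd true (odd-near k false))
               (opposite-odd false (odd-near k false))
      ... | i , _ , L , M , σ , τ , c
        with G.two (near k false) (pole false) (near i true) v Eq.refl (G.at-pole _) Eq.refl Eq.refl
               (near-≢-near k i false) (≢-sym v≢) (Eq.trans (odd-near i true) (Eq.sym (odd-near k false)))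
               (opposite-odd false (odd-near k false))
               (Eq.trans ev (cong not (Eq.sym (odd-near k false))))
      ... | L′ , M′ , σ′ , τ′ , c′
        with glue τ (join (rev σ′) (~-sym (bridge k false)) (join σ (bridge i true) τ′))
      ...   | K , κ , k′ = spanning true κ
        (↭-trans (prep _ k′)
        (↭-trans (solve 5 (λ p m l′ l m′ → p ⊕ (m ⊕ (l′ ⊕ (l ⊕ m′))) ⊜ (p ⊕ (l ⊕ m)) ⊕ (l′ ⊕ m′)) ↭-refl
                    [ P true ] M L′ L M′)
                 (++⁺ c c′)))

      -- The excursion into the second cube starts next to `pole b` and returns next to the opposite
      -- pole. The choice of `b` keeps `pole b` and `v`, the sinks of the two tours in the first
      -- cube, distinct.
      same-side-odd-even : ∀ u v → parity u ≡ true → parity v ≡ false → Spanning f g (f u) (f v)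
      same-side-odd-even u v eu ev = via (other-pole v)
        where
        other-pole : ∀ v → ∃[ b ] pole {n′} b ≢ v
        other-pole v with v ≟ pole true
        ... | yes Eq.refl = false , pole-≢ false
        ... | no v≢       = true , ≢-sym v≢
        via : (∃[ b ] pole {n′} b ≢ v) → Spanning f g (f u) (f v)
        via (b , b≢v) with near-avoiding (not b) u u
        ... | k , a≢u , _
          with F.two-cut-pole b u (near k (not b)) v Eq.refl (≢-sym a≢u) b≢v
                 (Eq.trans (odd-near k (not b)) (Eq.sym eu)) (opposite-odd b eu)
                 (Eq.trans ev (cong not (Eq.sym eu)))
        ... | i , _ , L , M , σ , τ , c
          with G.without (pole (not b)) (near i b) (near k (not b)) (G.at-pole _) Eq.refl Eq.refl
                 (near-≢-near i k b) (Eq.trans (odd-near k (not b)) (Eq.sym (odd-near i b)))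
                 (opposite-odd (not b) (odd-near i b))
        ... | N , ρ , d = spanning b (join σ (bridge i b) (join ρ (~-sym (bridge k (not b))) τ))
          (↭-trans (solve 5 (λ p q l n m → p ⊕ (q ⊕ (l ⊕ (n ⊕ m))) ⊜ (p ⊕ (l ⊕ m)) ⊕ (q ⊕ n)) ↭-refl
                      [ P b ] [ P (not b) ] L N M)
                   (++⁺ c d))

      -- Since the first tour ends in a₃ = near j b, different from a₁ = near i b on the second one,
      -- a₃ and v lie in the half of direction i that does not contain a₁ and a₂.
      across-even-even : ∀ b u v → parity u ≡ false → parity v ≡ false → pole b ≢ u → pole (not b) ≢ v →
                         Spanning f g (f u) (g v)
      across-even-even b u v eu ev b≢u b≢v with separate (pole (not b)) v b≢v
      ... | i , vi with third i i
      ... | k , k≢i , _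
        with F.two-cut-pole b a₂ a₁ u Eq.refl (≢-sym (near-≢-near i k b)) b≢u
               (Eq.trans (odd-near i b) (Eq.sym (odd-near k (not b))))
               (opposite-odd b (odd-near k (not b)))
               (Eq.trans eu (cong not (Eq.sym (odd-near k (not b)))))
           | G.without-part i (not b) (pole (not b)) a₁ a₂ (G.at-pole _) Eq.refl Eq.refl
               (Vec.lookup-replicate i (not b)) (lookup-near i b) (lookup-near-≢ (not b) k≢i)
               (near-≢-near i k b) (Eq.trans (odd-near k (not b)) (Eq.sym (odd-near i b)))
               (opposite-odd (not b) (odd-near i b))
        where
        a₁ a₂ : C
        a₁ = near i b
        a₂ = near k (not b)
      ... | j , a₃≢a₁ , L , M , σ , τ , c | N , ρ , d =
        spanning b
          (join (rev τ) (bridge i b) (join ρ (~-sym (bridge k (not b))) (join σ (bridge j b)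
            (G.tour-part i b (near j b) v Eq.refl Eq.refl (lookup-near-≢ {i = j} {i} b λ { Eq.refl → a₃≢a₁ Eq.refl })
              (not² (Eq.trans vi (cong not (Vec.lookup-replicate i (not b)))))
              (Eq.trans ev (cong not (Eq.sym (odd-near j b))))))))
          (↭-trans (solve 6 (λ p q m n l h → p ⊕ (q ⊕ (m ⊕ (n ⊕ (l ⊕ h)))) ⊜ (p ⊕ (l ⊕ m)) ⊕ (h ⊕ (q ⊕ n))) ↭-refl
                      [ P b ] [ P (not b) ] M N L (G.part i b))
                   (++⁺ c (↭-trans (++⁺ˡ (G.part i b) d) (G.parts i b))))

      -- The first cube is halved in a direction `i` separating the ends, the second in another
      -- direction `j`. The path runs from `u` to `a₁`, through one half of the second cube to
      -- `pole b`, in the half of `u` on to `a₃`, through the other half of the second cube to `a₄`,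
      -- and through the last half to `v`. The half of `u` carries two tours, hence `TwoLaceable`
      -- one dimension lower.
      same-side-even-even : TwoLaceable (suc (suc m)) → ∀ u v → u ≢ v → parity u ≡ false → parity v ≡ false →
                            (∀ b → u ≢ pole b) → Spanning f g (f u) (f v)
      same-side-even-even lac u v u≢v eu ev u≢ with separate u v u≢v
      ... | i , vi with third i i
      ... | j , j≢i , _ with third i j
      ... | k , k≢i , k≢j
        with F.two-part lac i b u a₁ (pole b) a₃ Eq.refl Eq.refl (F.at-pole _) Eq.refl
               Eq.refl (lookup-near-≢ b k≢i) (Vec.lookup-replicate i b) (lookup-near-≢ b j≢i)
               (u≢ b) (near-injective k j b k≢j) (Eq.trans (even b) (Eq.sym eu))
               (Eq.trans (odd-near k b) (cong not (Eq.sym eu))) (Eq.trans (odd-near j b) (cong not (Eq.sym eu)))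
           | G.without-part j (not b) (pole (not b)) a₃ a₄ (G.at-pole _) Eq.refl Eq.refl
               (Vec.lookup-replicate j (not b)) (lookup-near j b) (lookup-near-≢ (not b) k≢j)
               (near-≢-near j k b) (Eq.trans (odd-near k (not b)) (Eq.sym (odd-near j b)))
               (opposite-odd (not b) (odd-near j b))
        where
        b = lookup u i
        a₁ a₃ a₄ : C
        a₁ = near k b
        a₃ = near j b
        a₄ = near k (not b)
      ... | L , M , σ , τ , c | N , ρ , d
        with glue (join σ (bridge k b)
                    (G.tour-part j b (near k b) (pole b) Eq.refl (G.at-pole _) (lookup-near-≢ b k≢j)
                      (Vec.lookup-replicate j b) (opposite-odd b (odd-near k b))))
                  (join τ (bridge j b) (join ρ (~-sym (bridge k (not b)))
                    (F.tour-part i (not b) (near k (not b)) v Eq.refl Eq.refl (lookup-near-≢ (not b) k≢i) vi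
                      (Eq.trans ev (cong not (Eq.sym (odd-near k (not b))))))))
        where b = lookup u i
      ... | K , κ , kk = spanning b κ
        (↭-trans (swap _ _ ↭-refl)
        (↭-trans (prep _ kk)
        (↭-trans (solve 6 (λ q l h m n h′ → q ⊕ ((l ⊕ h) ⊕ (m ⊕ (n ⊕ h′))) ⊜ ((l ⊕ m) ⊕ h′) ⊕ (h ⊕ (q ⊕ n))) ↭-refl
                    [ P (not b) ] L (G.part j b) M N (F.part i (not b)))
                 (++⁺ (↭-trans (++⁺ʳ (F.part i (not b)) c) (F.parts i b))
                      (↭-trans (++⁺ˡ (G.part j b) d) (G.parts j b))))))
        where b = lookup u i

      -- A suitable `b` for `across-even-even` is lacking only if `u` and `v` are the same pole.
      across-even : ∀ u v → parity u ≡ false → parity v ≡ false → (∀ b → u ≡ pole b → v ≢ pole b) →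
                    Spanning f g (f u) (g v)
      across-even u v eu ev ne with u ≟ pole true | v ≟ pole false
      ... | no u≢ | no v≢  = across-even-even true u v eu ev (≢-sym u≢) (≢-sym v≢)
      ... | yes u≡ | _     = across-even-even false u v eu ev
        (λ { Eq.refl → pole-≢ false u≡ }) (≢-sym (ne true u≡))
      ... | no _ | yes v≡  = across-even-even false u v eu ev
        (λ e → ne false (Eq.sym e) v≡) (λ { Eq.refl → pole-≢ true v≡ })

  pole? : ∀ (u : C) → (∃[ b ] u ≡ pole b) ⊎ (∀ b → u ≢ pole b)
  pole? u with u ≟ pole false | u ≟ pole true
  ... | yes e | _     = inj₁ (false , e)
  ... | no _  | yes e = inj₁ (true , e)
  ... | no p  | no q  = inj₂ λ { false → p ; true → q }

  module OddConnected (odd : ∀ b → parity (pole {n′} b) ≡ b) where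

    same-side : ∀ {f g} → TwoCubes f g → Spanning f g (P false) (P true) →
                ∀ u v → u ≢ v → Spanning f g (f u) (f v)
    same-side H polar u v u≢v with bool-dichotomy (parity u) (parity v)
    ... | inj₁ e = Sides.Odd.same-side-same-parity H odd u v u≢v e
    ... | inj₂ e = Sides.Odd.same-side-opposite-parity H odd polar u v e

    across : ∀ {f g} → TwoCubes f g → Spanning f g (P false) (P true) →
             ∀ u v → f u ≢ g v → Spanning f g (f u) (g v)
    across {f} {g} H polar u v ne with pole? u | pole? v
    -- A pole belongs to both cubes, so it may be moved to the side of the other end.
    ... | _ | inj₁ (b , Eq.refl) = subst (Spanning f g (f u)) (Sides.poles-agree H b)
      (same-side H polar u (pole b) λ { Eq.refl → ne (Sides.poles-agree H b) })
    ... | inj₁ (b , Eq.refl) | inj₂ _ = subst (λ x → Spanning f g x (g v)) (Eq.sym (Sides.poles-agree H b))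
      (spanning-flip (same-side (flip-sides H) (spanning-flip polar) (pole b) v
        λ { Eq.refl → ne (Sides.poles-agree H b) }))
    ... | inj₂ u≢ | inj₂ v≢ with bool-dichotomy (parity u) (parity v)
    ...   | inj₁ e = Sides.Odd.across-same-parity H odd u v e (u≢ _) (v≢ _)
    ...   | inj₂ e = Sides.Odd.across-opposite-parity H odd u v e (v≢ _)

  module EvenConnected (even : ∀ b → parity (pole {n′} b) ≡ false) (lac : TwoLaceable (suc (suc m))) where

    same-side : ∀ {f g} → TwoCubes f g → ∀ u v → u ≢ v → Spanning f g (f u) (f v)
    same-side {f} {g} H u v u≢v with parity u in eu | parity v in ev
    ... | true  | true  = Sides.Even.same-side-odd-odd H even u v u≢v eu ev
    ... | true  | false = Sides.Even.same-side-odd-even H even u v eu ev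
    ... | false | true  = spanning-sym (Sides.Even.same-side-odd-even H even v u ev eu)
    ... | false | false with pole? u | pole? v
    ...   | inj₂ u≢ | _ = Sides.Even.same-side-even-even H even lac u v u≢v eu ev u≢
    ...   | inj₁ _ | inj₂ v≢ = spanning-sym (Sides.Even.same-side-even-even H even lac v u (≢-sym u≢v) ev eu v≢)
    -- Of two poles, the second is read in the other cube.
    ...   | inj₁ _ | inj₁ (c , Eq.refl) = subst (Spanning f g (f u)) (Eq.sym (Sides.poles-agree H c))
      (Sides.Even.across-even H even u v eu ev λ { b Eq.refl → ≢-sym u≢v })

    across-odd-even : ∀ {f g} → TwoCubes f g → ∀ u v → parity u ≡ true → parity v ≡ false → Spanning f g (f u) (g v)
    across-odd-even {f} {g} H u v eu ev with v ≟ pole false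
    ... | no v≢       = Sides.Even.across-odd-even H even u v eu ev v≢
    ... | yes Eq.refl = subst (Spanning f g (f u)) (Sides.poles-agree H false)
      (Sides.Even.same-side-odd-even H even u v eu ev)

    across : ∀ {f g} → TwoCubes f g → ∀ u v → f u ≢ g v → Spanning f g (f u) (g v)
    across H u v ne with parity u in eu | parity v in ev
    ... | true  | true  = Sides.Even.across-odd-odd H even u v eu ev
    ... | true  | false = across-odd-even H u v eu ev
    ... | false | true  = spanning-flip (spanning-sym (across-odd-even (flip-sides H) v u ev eu))
    ... | false | false = Sides.Even.across-even H even u v eu ev
      λ { b Eq.refl Eq.refl → ne (Sides.poles-agree H b) }

  -- Only the poles of an odd-dimensional cube need a bridge between vertices of opposite parity.
  polar : ∀ {f g} → TwoCubes f g → (∀ b → parity (pole {n′} b) ≡ b) →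
          f (flipAt (suc zero) (near zero false)) ~ g (near zero false) → Spanning f g (P false) (P true)
  polar H odd r
    -- Each cube omits the pole that is the end of the path in the other cube.
    with F.without (pole true) (pole false) c (F.at-pole _) (F.at-pole _) Eq.refl
           (λ ()) ec (Eq.trans (odd true) (cong not (Eq.sym (odd false))))
       | G.without (pole false) (near zero false) (pole true) (G.at-pole _) Eq.refl (G.at-pole _)
           (near-≢-pole zero false) (Eq.trans (odd true) (Eq.sym ea)) (Eq.trans (odd false) (cong not (Eq.sym ea)))
    where
    module F = Side (TwoCubes.F H)
    module G = Side (TwoCubes.G H)
    c : C
    c = flipAt (suc zero) (near zero false)
    ec = parity-flip-twice {n′} (suc zero) zero (pole false)
    ea = parity-near {n′} zero false (odd false)
  ... | L , σ , p | M , τ , q = spanning false (join σ r τ)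
    (↭-trans (solve 4 (λ a b l m → a ⊕ (b ⊕ (l ⊕ m)) ⊜ (b ⊕ l) ⊕ (a ⊕ m)) ↭-refl [ P false ] [ P true ] L M)
             (++⁺ p q))

  -- An even dimension above two is at least four, so its halves have dimension at least three,
  -- where `twoLaceable` begins.
  four-or-more : ∀ m → parity (pole {suc (suc (suc m))} true) ≡ false → TwoLaceable (suc (suc m))
  four-or-more zero    ()
  four-or-more (suc m) _ = twoLaceable m

  SpanningConnected : (f g : C → V) → Set
  SpanningConnected f g = (∀ u v → u ≢ v → Spanning f g (f u) (f v)) × (∀ u v → u ≢ v → Spanning f g (g u) (g v)) ×
                          (∀ u v → f u ≢ g v → Spanning f g (f u) (g v))

  spanning-connected : ∀ {f g} → TwoCubes f g → f (flipAt (suc zero) (near zero false)) ~ g (near zero false) →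
                       SpanningConnected f g
  spanning-connected H r with parity (pole {n′} true) in eq
  ... | true = same-side H π , (λ u v ne → spanning-flip (same-side (flip-sides H) (spanning-flip π) u v ne)) , across H π
    where
    odd : ∀ b → parity (pole {n′} b) ≡ b
    odd false = parity-replicate n′
    odd true  = eq
    π = polar H odd r
    open OddConnected odd
  ... | false = same-side H , (λ u v ne → spanning-flip (same-side (flip-sides H) u v ne)) , across H
    where
    even : ∀ b → parity (pole {n′} b) ≡ false
    even false = parity-replicate n′
    even true  = eq
    open EvenConnected even (four-or-more m eq)

-- The cyclic successor

next-inject₁ : ∀ {m} (i : Fin m) → next (inject₁ i) ≡ suc i
next-inject₁ {m} i with suc (toℕ (inject₁ i)) <? suc m
... | yes p = Fin.toℕ-injective (Eq.trans (Fin.toℕ-fromℕ< p) (cong suc (Fin.toℕ-inject₁ i)))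
... | no ¬p = contradiction (s≤s (subst (λ k → suc k ≤ m) (Eq.sym (Fin.toℕ-inject₁ i)) (Fin.toℕ<n i))) ¬p

next-fromℕ : ∀ m → next (fromℕ m) ≡ zero
next-fromℕ m with suc (toℕ (fromℕ m)) <? suc m
... | yes p = contradiction p (subst (λ k → ¬ suc k < suc m) (Eq.sym (Fin.toℕ-fromℕ m)) (ℕ.<-irrefl Eq.refl))
... | no _  = Eq.refl

prev : Fin n → Fin n
prev zero    = fromℕ _
prev (suc i) = inject₁ i

next-prev : (i : Fin n) → next (prev i) ≡ i
next-prev zero    = next-fromℕ _
next-prev (suc i) = next-inject₁ i

prev-next : (i : Fin n) → prev (next i) ≡ i
prev-next i with view i
... | ‵fromℕ {n = m} rewrite next-fromℕ m  = Eq.refl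
... | ‵inject₁ j rewrite next-inject₁ j = Eq.refl

next-injective : {i j : Fin n} → next i ≡ next j → i ≡ j
next-injective {i = i} {j} e = Eq.trans (Eq.sym (prev-next i)) (Eq.trans (cong prev e) (prev-next j))

next-≢ : ∀ {m} (i : Fin (suc (suc m))) → next i ≢ i
next-≢ i e with view i
next-≢ _ e | ‵fromℕ {n = m} with () ← Eq.trans (Eq.sym (next-fromℕ m)) e
next-≢ _ e | ‵inject₁ j =
  ℕ.1+n≢n (Eq.trans (cong toℕ (Eq.trans (Eq.sym (next-inject₁ j)) e)) (Fin.toℕ-inject₁ j))

-- Climb from `k` to the last index, wrap around to zero, and climb through all indices. The first
-- climb is a downward induction on its starting point.
next-induction : (P : Fin n → Set) → ∀ k → P k → (∀ i → P i → P (next i)) → ∀ j → P j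
next-induction {suc m} P k pk adv = <-weakInduction P
  (subst P (next-fromℕ m) (adv _ (>-weakInduction (λ i → P i → P (fromℕ m)) id
    (λ i up p → up (subst P (next-inject₁ i) (adv _ p))) k pk)))
  (λ i p → subst P (next-inject₁ i) (adv _ p))

prev-induction : (P : Fin n → Set) → ∀ k → P k → (∀ i → P (next i) → P i) → ∀ j → P j
prev-induction {suc m} P k pk adv = >-weakInduction P
  (adv _ (subst P (Eq.sym (next-fromℕ m)) (<-weakInduction (λ i → P i → P zero) id
    (λ i down p → down (adv _ (subst P (Eq.sym (next-inject₁ i)) p))) k pk)))
  (λ i p → adv _ (subst P (Eq.sym (next-inject₁ i)) p))

-- Edges and reachability in the wheel

rim spoke : Fin n → Edge n
rim {n} i = i ↑ˡ n
spoke {n} i = n ↑ʳ i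

data EdgeView {n} : Edge n → Set where
  is-rim   : (i : Fin n) → EdgeView (rim i)
  is-spoke : (i : Fin n) → EdgeView (spoke i)

edgeView : ∀ {n} (e : Edge n) → EdgeView {n} e
edgeView {n} e with splitAt n e in eq
... | inj₁ i = subst (EdgeView {n}) (Fin.splitAt⁻¹-↑ˡ eq) (is-rim i)
... | inj₂ i = subst (EdgeView {n}) (Fin.splitAt⁻¹-↑ʳ {n} eq) (is-spoke i)

ends-rim : (i : Fin n) → ends (rim i) ≡ (just i , just (next i))
ends-rim {n} i rewrite Fin.splitAt-↑ˡ n i n = Eq.refl

ends-spoke : (i : Fin n) → ends {n} (spoke i) ≡ (nothing , just i)
ends-spoke {n} i rewrite Fin.splitAt-↑ʳ n n i = Eq.refl

IsRim-rim : (i : Fin n) → IsRim {n} (rim i)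
IsRim-rim {n} i rewrite Fin.splitAt-↑ˡ n i n = _

¬IsRim-spoke : (i : Fin n) → ¬ IsRim {n} (spoke i)
¬IsRim-spoke {n} i rewrite Fin.splitAt-↑ʳ n n i = id

rim≢spoke : {i j : Fin n} → rim i ≢ spoke j
rim≢spoke {i = i} {j} e with () ← Eq.trans (Eq.sym (ends-rim i)) (Eq.trans (cong ends e) (ends-spoke j))

spoke-injective : {i j : Fin n} → spoke i ≡ spoke j → i ≡ j
spoke-injective {n} e = Fin.↑ʳ-injective n _ _ e

Joins-sym : ∀ {e : Edge n} {x y} → Joins {n} e x y → Joins {n} e y x
Joins-sym (inj₁ e) = inj₂ e
Joins-sym (inj₂ e) = inj₁ e

Joins-unique : ∀ {e : Edge n} {x y a b} → Joins {n} e a b → Joins {n} e x y → (x ≡ a × y ≡ b) ⊎ (x ≡ b × y ≡ a)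
Joins-unique (inj₁ p) (inj₁ q) with Eq.refl ← Eq.trans (Eq.sym q) p = inj₁ (Eq.refl , Eq.refl)
Joins-unique (inj₁ p) (inj₂ q) with Eq.refl ← Eq.trans (Eq.sym q) p = inj₂ (Eq.refl , Eq.refl)
Joins-unique (inj₂ p) (inj₁ q) with Eq.refl ← Eq.trans (Eq.sym q) p = inj₂ (Eq.refl , Eq.refl)
Joins-unique (inj₂ p) (inj₂ q) with Eq.refl ← Eq.trans (Eq.sym q) p = inj₁ (Eq.refl , Eq.refl)

module _ {T : EdgeSet n} where

  reach-trans : ∀ {x y z} → Reach n T x y → Reach n T y z → Reach n T x z
  reach-trans here           s = s
  reach-trans (step e m j r) s = step e m j (reach-trans r s)

  reach-sym : ∀ {x y} → Reach n T x y → Reach n T y x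
  reach-sym here           = here
  reach-sym (step e m j r) = reach-trans (reach-sym r) (step e m (Joins-sym {n} {e} j) here)

  connected-from : (∀ i → Reach n T (just i) nothing) → Connected n T
  connected-from r x y = reach-trans (to-centre x) (reach-sym (to-centre y))
    where
    to-centre : ∀ x → Reach n T x nothing
    to-centre nothing  = here
    to-centre (just i) = r i

∉-removed : ∀ {n} (p : Vec Bool n) i → ¬ (i ∈ˢ p ─ ⁅ i ⁆)
∉-removed (_ ∷ p) zero    ()
∉-removed (_ ∷ p) (suc i) (there m) = ∉-removed p i m

∈-kept : ∀ {n} {p : Vec Bool n} {i j} → i ∈ˢ p → i ≢ j → i ∈ˢ p ─ ⁅ j ⁆
∈-kept m ne = Subset.x∈p∧x∉q⇒x∈p─q m (λ q → ne (Subset.x∈⁅y⁆⇒x≡y _ q))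

-- Without the edge pe i, the descendants of child i are cut off from the centre.
module ParentEdges {T : EdgeSet n} (pe : Fin n → Edge n) (child : Fin n → Fin n) (par : Fin n → Vertex n)
  (child-injective : ∀ {i j} → child i ≡ child j → i ≡ j)
  (joins : ∀ i → Joins {n} (pe i) (just (child i)) (par i))
  (covers : ∀ e → e ∈ˢ T → ∃[ i ] e ≡ pe i) where

  data Below (i : Fin n) : Vertex n → Set where
    top  : Below i (just (child i))
    down : ∀ j → Below i (par j) → Below i (just (child j))

  below-inv : ∀ {i j x} → Below i x → x ≡ just (child j) → j ≢ i → Below i (par j)
  below-inv top        e j≢i = contradiction (Eq.sym (child-injective (just-injective e))) j≢i
  below-inv (down k b) e j≢i with Eq.refl ← child-injective (just-injective e) = b

  below-closed : ∀ {i x y} → Below i x → Reach n (T ─ ⁅ pe i ⁆) x y → Below i y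
  below-closed b here = b
  below-closed {i} b (step e m j r) with covers e (Subset.p─q⊆p T ⁅ pe i ⁆ m)
  ... | k , Eq.refl with Joins-unique {n} {pe k} (joins k) j
  ...   | inj₁ (Eq.refl , Eq.refl) =
          below-closed (below-inv b Eq.refl λ { Eq.refl → ∉-removed T (pe i) m }) r
  ...   | inj₂ (Eq.refl , Eq.refl) = below-closed (down k b) r

  spanning-tree : (∀ i → Reach n T (just i) nothing) → IsSpanningTree n T
  spanning-tree r = connected-from r , minimal
    where
    minimal : ∀ e → e ∈ˢ T → ¬ Connected n (T ─ ⁅ e ⁆)
    minimal e m c with covers e m
    -- The centre is no descendant: both constructors of `Below` yield rim vertices.
    ... | i , Eq.refl with below-closed top (c (just (child i)) nothing)
    ... | ()

-- The two families of base-cobases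

lookup-ext : ∀ {n} {x y : Vec Bool n} → (∀ i → lookup x i ≡ lookup y i) → x ≡ y
lookup-ext {x = x} {y} e =
  Eq.trans (Eq.sym (Vec.tabulate∘lookup x)) (Eq.trans (Vec.tabulate-cong e) (Vec.tabulate∘lookup y))

rotate : Vec Bool n → Vec Bool n
rotate x = tabulate (λ i → lookup x (prev i))

lookup-rotate : ∀ (x : Vec Bool n) i → lookup (rotate x) i ≡ lookup x (prev i)
lookup-rotate x i = Vec.lookup∘tabulate _ i

lookup-rotate-next : ∀ (x : Vec Bool n) i → lookup (rotate x) (next i) ≡ lookup x i
lookup-rotate-next x i = Eq.trans (lookup-rotate x (next i)) (cong (lookup x) (prev-next i))

-- The bits of x mark the missing rim edges, those of S the spokes present.
edges : Vec Bool n → Vec Bool n → EdgeSet n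
edges x S = Vec.map not x Vec.++ S

-- `setA` ties the spoke at a rim vertex to the rim edge starting there, `setB` to the rim edge
-- ending there.
setA setB : Vec Bool n → EdgeSet n
setA x = edges x x
setB x = edges x (rotate x)

lookup-rim : ∀ (x S : Vec Bool n) i → lookup (edges x S) (rim i) ≡ not (lookup x i)
lookup-rim x S i = Eq.trans (Vec.lookup-++ˡ (Vec.map not x) S i) (Vec.lookup-map i not x)

lookup-spoke : ∀ (x S : Vec Bool n) i → lookup (edges x S) (spoke i) ≡ lookup S i
lookup-spoke x S i = Vec.lookup-++ʳ (Vec.map not x) S i

rim∈ : ∀ (x S : Vec Bool n) {i} → lookup x i ≡ false → rim i ∈ˢ edges x S
rim∈ x S {i} e = Vec.lookup⇒[]= _ _ (Eq.trans (lookup-rim x S i) (cong not e))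

rim∈⁻¹ : ∀ (x S : Vec Bool n) {i} → rim i ∈ˢ edges x S → lookup x i ≡ false
rim∈⁻¹ x S {i} m = Bool.not-injective (Eq.trans (Eq.sym (lookup-rim x S i)) (Vec.[]=⇒lookup m))

spoke∈ : ∀ (x S : Vec Bool n) {i} → lookup S i ≡ true → spoke i ∈ˢ edges x S
spoke∈ x S {i} e = Vec.lookup⇒[]= _ _ (Eq.trans (lookup-spoke x S i) e)

spoke∈⁻¹ : ∀ (x S : Vec Bool n) {i} → spoke i ∈ˢ edges x S → lookup S i ≡ true
spoke∈⁻¹ x S {i} m = Eq.trans (Eq.sym (lookup-spoke x S i)) (Vec.[]=⇒lookup m)

edges-rim-set : ∀ (x S : Vec Bool n) → (∀ i → lookup x i ≡ false) → (∀ i → lookup S i ≡ false) →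
                IsRimSet n (edges x S)
edges-rim-set {n} x S hx hS e with edgeView {n} e
... | is-rim i   = (λ _ → IsRim-rim i) , (λ _ → rim∈ x S (hx i))
... | is-spoke i = (λ m → contradiction (Eq.trans (Eq.sym (spoke∈⁻¹ x S m)) (hS i)) λ ()) ,
                   (λ r → contradiction r (¬IsRim-spoke i))

true-or-none : ∀ (x : Vec Bool n) → (∃[ i ] lookup x i ≡ true) ⊎ (∀ i → lookup x i ≡ false)
true-or-none {n} x with Fin.any? (λ i → lookup x i Bool.≟ true)
... | yes t = inj₁ t
... | no ¬t = inj₂ (λ i → Bool.¬-not (λ e → ¬t (i , e)))

-- The spoke at child i is present iff the rim edge i is not; so one of the two is the parent edge of child i.
module Orientation (x S : Vec Bool n) (child other : Fin n → Fin n)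
  (child-injective : ∀ {i j} → child i ≡ child j → i ≡ j)
  (child-surjective : ∀ j → ∃[ i ] child i ≡ j)
  (joins-rim : ∀ i → Joins {n} (rim i) (just (child i)) (just (other i)))
  (induction : (P : Fin n → Set) → ∀ k → P (child k) → (∀ i → P (other i) → P (child i)) → ∀ j → P j)
  (matching : ∀ i → lookup S (child i) ≡ lookup x i) where

  private
    parent-edge : Bool → Fin n → Edge n
    parent-edge true  i = spoke (child i)
    parent-edge false i = rim i

    parent : Bool → Fin n → Vertex n
    parent true  i = nothing
    parent false i = just (other i)

    joins : ∀ b i → Joins {n} (parent-edge b i) (just (child i)) (parent b i)
    joins true  i = inj₂ (ends-spoke (child i))
    joins false i = joins-rim i

    covers : ∀ e → e ∈ˢ edges x S → ∃[ i ] e ≡ parent-edge (lookup x i) i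
    covers e m with edgeView {n} e
    ... | is-rim i = i , cong (λ b → parent-edge b i) (Eq.sym (rim∈⁻¹ x S m))
    ... | is-spoke j with i , Eq.refl ← child-surjective j =
          i , cong (λ b → parent-edge b i) (Eq.sym (Eq.trans (Eq.sym (matching i)) (spoke∈⁻¹ x S m)))

    climb : ∀ i → Reach n (edges x S) (just (other i)) nothing → Reach n (edges x S) (just (child i)) nothing
    climb i r with lookup x i in eq
    ... | true  = step (spoke (child i)) (spoke∈ x S (Eq.trans (matching i) eq)) (joins true i) here
    ... | false = step (rim i) (rim∈ x S eq) (joins-rim i) r

  whirl-base : IsWhirlBase n (edges x S)
  whirl-base with true-or-none x
  -- No rim edge is missing: this is the base that the whirl has beyond the spanning trees.
  ... | inj₂ none = inj₂ (edges-rim-set x S none λ j → spokeless j (child-surjective j))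
    where
    spokeless : ∀ j → ∃[ i ] child i ≡ j → lookup S j ≡ false
    spokeless _ (i , Eq.refl) = Eq.trans (matching i) (none i)
  -- A missing rim edge `k` puts a spoke at `child k`; from there connection to the centre spreads
  -- around the rim.
  ... | inj₁ (k , xk) = inj₁ (ParentEdges.spanning-tree (λ i → parent-edge (lookup x i) i) child (λ i → parent (lookup x i) i)
      child-injective (λ i → joins (lookup x i) i) covers
      (induction (λ j → Reach n (edges x S) (just j) nothing) k
        (step (spoke (child k)) (spoke∈ x S (Eq.trans (matching k) xk)) (joins true k) here) climb))

-- Rim edges are directed from `i` to `next i`, towards the parent, so the induction runs backwards;
-- for `setB` both are reversed.
setA-base : ∀ (x : Vec Bool n) → IsWhirlBase n (setA x)
setA-base x = Orientation.whirl-base x x id next id (λ j → j , Eq.refl) (λ i → inj₁ (ends-rim i))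
  prev-induction (λ _ → Eq.refl)

setB-base : ∀ (x : Vec Bool n) → IsWhirlBase n (setB x)
setB-base x = Orientation.whirl-base x (rotate x) next id next-injective (λ j → prev j , next-prev j)
  (λ i → inj₂ (ends-rim i)) (λ P k → next-induction P (next k)) (lookup-rotate-next x)

∁-edges : ∀ (x S : Vec Bool n) → ∁ (edges x S) ≡ edges (Vec.map not x) (Vec.map not S)
∁-edges x S = Vec.map-++ not (Vec.map not x) S

rotate-not : ∀ (x : Vec Bool n) → Vec.map not (rotate x) ≡ rotate (Vec.map not x)
rotate-not x = lookup-ext λ i → begin
  lookup (Vec.map not (rotate x)) i ≡⟨ Vec.lookup-map i not (rotate x) ⟩
  not (lookup (rotate x) i)         ≡⟨ cong not (lookup-rotate x i) ⟩
  not (lookup x (prev i))           ≡⟨ Vec.lookup-map (prev i) not x ⟨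
  lookup (Vec.map not x) (prev i)   ≡⟨ lookup-rotate (Vec.map not x) i ⟨
  lookup (rotate (Vec.map not x)) i ∎
  where open ≡-Reasoning

-- Complementation negates the word and stays in the family, so the complement is a base for the
-- same reason.
setA-base-cobase : ∀ (x : Vec Bool n) → IsBaseCobase n (setA x)
setA-base-cobase {n} x = setA-base x , subst (IsWhirlBase n) (Eq.sym (∁-edges x x)) (setA-base (Vec.map not x))

setB-base-cobase : ∀ (x : Vec Bool n) → IsBaseCobase n (setB x)
setB-base-cobase {n} x = setB-base x , subst (IsWhirlBase n)
  (Eq.sym (Eq.trans (∁-edges x (rotate x)) (cong (edges (Vec.map not x)) (rotate-not x)))) (setB-base (Vec.map not x))

conflict : ∀ {b c} → c ≡ b → c ≡ not b → ⊥
conflict Eq.refl e = Bool.not-¬ Eq.refl e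

-- T false and T true are a base-cobase and its complement.
module TwoTrees (x S : Vec Bool n) (T : Bool → EdgeSet n) (tree : ∀ b → IsSpanningTree n (T b))
  (rim∈T : ∀ b i → lookup x i ≡ b → rim i ∈ˢ T b)
  (rim∈T⁻¹ : ∀ b i → rim i ∈ˢ T b → lookup x i ≡ b)
  (spoke∈T : ∀ b i → lookup S i ≡ not b → spoke i ∈ˢ T b)
  (spoke∈T⁻¹ : ∀ b i → spoke i ∈ˢ T b → lookup S i ≡ not b) where

  -- Otherwise the vertex next i would be isolated in T (not b).
  local : ∀ i b → lookup x i ≡ b → lookup x (next i) ≡ b → lookup S (next i) ≡ b
  local i b e e′ with bool-dichotomy b (lookup S (next i))
  ... | inj₁ s = s
  ... | inj₂ s = ⊥-elim (isolated (proj₁ (tree (not b)) (just (next i)) nothing))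
    where
    isolated : ¬ Reach n (T (not b)) (just (next i)) nothing
    isolated (step d m j _) with edgeView {n} d
    ... | is-rim k with Joins-unique {n} {rim k} (inj₁ (ends-rim k)) j
    ...   | inj₁ (Eq.refl , _) = conflict e′ (rim∈T⁻¹ _ _ m)
    ...   | inj₂ (p , _) with Eq.refl ← next-injective (just-injective p) = conflict e (rim∈T⁻¹ _ _ m)
    isolated (step d m j _) | is-spoke k with Joins-unique {n} {spoke k} (inj₁ (ends-spoke k)) j
    ...   | inj₁ (() , _)
    ...   | inj₂ (Eq.refl , _) = conflict s (spoke∈T⁻¹ _ _ m)

  -- Otherwise spoke `k` is redundant in the tree: each use of it can be rerouted along the rim and
  -- through spoke `l`, against minimality.
  one-spoke-per-arc : ∀ b k l → lookup S k ≡ not b → lookup S l ≡ not b → k ≢ l →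
                      ¬ Reach n (T b ─ ⁅ spoke k ⁆) (just k) (just l)
  one-spoke-per-arc b k l sk sl k≢l r =
    proj₂ (tree b) (spoke k) (spoke∈T b k sk) (λ y z → reroute (proj₁ (tree b) y z))
    where
    detour : Reach n (T b ─ ⁅ spoke k ⁆) (just k) nothing
    detour = reach-trans r (step (spoke l) (∈-kept (spoke∈T b l sl) (k≢l ∘ Eq.sym ∘ spoke-injective))
                                 (inj₂ (ends-spoke l)) here)
    reroute : ∀ {y z} → Reach n (T b) y z → Reach n (T b ─ ⁅ spoke k ⁆) y z
    reroute here = here
    reroute (step e m j t) with e Fin.≟ spoke k
    ... | no e≢ = step e (∈-kept m e≢) j (reroute t)
    ... | yes Eq.refl with Joins-unique {n} {spoke k} (inj₁ (ends-spoke k)) j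
    ...   | inj₁ (Eq.refl , Eq.refl) = reach-trans (reach-sym detour) (reroute t)
    ...   | inj₂ (Eq.refl , Eq.refl) = reach-trans detour (reroute t)

  -- An arc of rim edges of T (lookup x j) leads from k to j, and k carries the spoke of that arc.
  ArcEnd : Fin n → Set
  ArcEnd j = lookup S j ≡ lookup x (prev j) × ∃[ k ] lookup x k ≡ lookup x j × lookup S k ≡ not (lookup x j) ×
             Reach n (T (lookup x j) ─ ⁅ spoke k ⁆) (just k) (just j)

  -- By `local`, a disagreement of `S` with `x` at `j` can only occur where an arc begins, and then
  -- this arc has its spoke at its first vertex `j`.
  arc-start : ∀ j → lookup S j ≢ lookup x j → ArcEnd j
  arc-start j ne with bool-dichotomy (lookup x (prev j)) (lookup x j)
  ... | inj₂ e = Eq.trans s (not² (cong not e)) , j , Eq.refl , s , here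
    where s = Bool.¬-not ne
  ... | inj₁ e = ⊥-elim (ne (subst (λ k → lookup S k ≡ lookup x j) (next-prev j)
      (local (prev j) (lookup x j) (Eq.sym e) (cong (lookup x) (next-prev j)))))

  -- Either the arc continues along rim edge `j`, or an arc of the other tree starts at `next j`. In
  -- the latter case the spoke there goes to the new arc, for the old one already has its spoke at
  -- `k`.
  arc-step : ∀ j → ArcEnd j → ArcEnd (next j)
  arc-step j (_ , k , xk , sk , r) with bool-dichotomy (lookup x j) (lookup x (next j))
  ... | inj₁ e rewrite e = Eq.trans (local j (lookup x j) Eq.refl e) (cong (lookup x) (Eq.sym (prev-next j))) ,
        k , xk , sk , reach-trans r (step (rim j) (∈-kept (rim∈T _ j Eq.refl) rim≢spoke) (inj₁ (ends-rim j)) here)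
  ... | inj₂ e with bool-dichotomy (lookup x j) (lookup S (next j))
  ...   | inj₁ s = Eq.trans s (cong (lookup x) (Eq.sym (prev-next j))) , next j , Eq.refl ,
          Eq.trans s (Eq.sym (not² (cong not e))) , here
  ...   | inj₂ s = ⊥-elim (one-spoke-per-arc (lookup x j) k (next j) sk s (λ { Eq.refl → conflict xk e })
          (reach-trans r (step (rim j) (∈-kept (rim∈T _ j Eq.refl) rim≢spoke) (inj₁ (ends-rim j)) here)))

  -- A single disagreement with `x` propagates around the rim and forces agreement with `rotate x`
  -- everywhere.
  two-forms : S ≡ x ⊎ S ≡ rotate x
  two-forms with Fin.all? (λ j → lookup S j Bool.≟ lookup x j)
  ... | yes all = inj₁ (lookup-ext all)
  ... | no ¬all with j , ne ← Fin.¬∀⟶∃¬ n _ (λ j → lookup S j Bool.≟ lookup x j) ¬all =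
        inj₂ (lookup-ext λ i → Eq.trans (proj₁ (next-induction ArcEnd j (arc-start j ne) arc-step i))
                                        (Eq.sym (lookup-rotate x i)))

not-not : ∀ (x : Vec Bool n) → Vec.map not (Vec.map not x) ≡ x
not-not x = Eq.trans (Eq.sym (Vec.map-∘ not not x)) (Eq.trans (Vec.map-cong Bool.not-involutive x) (Vec.map-id x))

rim-set-edges : ∀ (x S : Vec Bool n) → IsRimSet n (edges x S) → S ≡ x
rim-set-edges {n} x S h = lookup-ext λ i →
  Eq.trans (Bool.¬-not λ s → ¬IsRim-spoke i (proj₁ (h (spoke i)) (spoke∈ x S s)))
           (Eq.sym (rim∈⁻¹ x S (proj₂ (h (rim i)) (IsRim-rim i))))

edges-two-forms : ∀ (x S : Vec Bool n) → IsWhirlBase n (edges x S) →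
                  IsWhirlBase n (edges (Vec.map not x) (Vec.map not S)) → S ≡ x ⊎ S ≡ rotate x
edges-two-forms x S (inj₂ h) _ = inj₁ (rim-set-edges x S h)
edges-two-forms x S (inj₁ _) (inj₂ h) = inj₁
  (Eq.trans (Eq.sym (not-not S)) (Eq.trans (cong (Vec.map not) (rim-set-edges _ _ h)) (not-not x)))
edges-two-forms {n} x S (inj₁ t) (inj₁ t′) = TwoTrees.two-forms x S T tree in-rim from-rim in-spoke from-spoke
  where
  x′ S′ : Vec Bool n
  x′ = Vec.map not x
  S′ = Vec.map not S
  T : Bool → EdgeSet n
  T false = edges x S
  T true  = edges x′ S′
  tree : ∀ b → IsSpanningTree n (T b)
  tree false = t
  tree true  = t′
  in-rim : ∀ b i → lookup x i ≡ b → rim i ∈ˢ T b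
  in-rim false i e = rim∈ x S e
  in-rim true  i e = rim∈ x′ S′ (Eq.trans (Vec.lookup-map i not x) (cong not e))
  from-rim : ∀ b i → rim i ∈ˢ T b → lookup x i ≡ b
  from-rim false i m = rim∈⁻¹ x S m
  from-rim true  i m = Bool.not-injective (Eq.trans (Eq.sym (Vec.lookup-map i not x)) (rim∈⁻¹ x′ S′ m))
  in-spoke : ∀ b i → lookup S i ≡ not b → spoke i ∈ˢ T b
  in-spoke false i e = spoke∈ x S e
  in-spoke true  i e = spoke∈ x′ S′ (Eq.trans (Vec.lookup-map i not S) (cong not e))
  from-spoke : ∀ b i → spoke i ∈ˢ T b → lookup S i ≡ not b
  from-spoke false i m = spoke∈⁻¹ x S m
  from-spoke true  i m = Bool.not-injective (Eq.trans (Eq.sym (Vec.lookup-map i not S)) (spoke∈⁻¹ x′ S′ m))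

base-cobase-forms : ∀ (B : EdgeSet n) → IsBaseCobase n B → ∃[ x ] (B ≡ setA x ⊎ B ≡ setB x)
base-cobase-forms {n} B bc with R , S , Eq.refl ← Vec.splitAt n B = Vec.map not R , form
  where
  x : Vec Bool n
  x = Vec.map not R
  split : R Vec.++ S ≡ edges x S
  split = cong (Vec._++ S) (Eq.sym (not-not R))
  form : R Vec.++ S ≡ setA x ⊎ R Vec.++ S ≡ setB x
  form with edges-two-forms x S (subst (IsWhirlBase n) split (proj₁ bc))
              (subst (IsWhirlBase n) (Eq.trans (cong ∁ split) (∁-edges x S)) (proj₂ bc))
  ... | inj₁ e = inj₁ (Eq.trans split (cong (edges x) e))
  ... | inj₂ e = inj₂ (Eq.trans split (cong (edges x) e))

-- Adjacency

-- Hamming distance in the form used by `Adjacent`, but for any length, so that rim edges and spokes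
-- can be counted separately.
distance : Cube n → Cube n → ℕ
distance x y = ∣ (x ─ y) ∪ (y ─ x) ∣

distance-++ : ∀ {k l} (a c : Cube k) (b d : Cube l) → distance (a Vec.++ b) (c Vec.++ d) ≡ distance a c + distance b d
distance-++ []          []          b d = Eq.refl
distance-++ (true ∷ a)  (true ∷ c)  b d = distance-++ a c b d
distance-++ (false ∷ a) (false ∷ c) b d = distance-++ a c b d
distance-++ (true ∷ a)  (false ∷ c) b d = cong suc (distance-++ a c b d)
distance-++ (false ∷ a) (true ∷ c)  b d = cong suc (distance-++ a c b d)

distance-refl : (x : Cube n) → distance x x ≡ 0
distance-refl []          = Eq.refl
distance-refl (true ∷ x)  = distance-refl x
distance-refl (false ∷ x) = distance-refl x

distance-flip : {x y : Cube n} → Flip x y → distance x y ≡ 1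
distance-flip (here {b = false} {v}) = cong suc (distance-refl v)
distance-flip (here {b = true} {v})  = cong suc (distance-refl v)
distance-flip (there {b = false} r)  = distance-flip r
distance-flip (there {b = true} r)   = distance-flip r

distance-flipAt : ∀ (i j : Fin n) x → i ≢ j → distance (flipAt i x) (flipAt j x) ≡ 2
distance-flipAt zero zero x i≢j = contradiction Eq.refl i≢j
distance-flipAt zero (suc j) (false ∷ x) _ = cong suc (distance-flip (flip-flipAt j x))
distance-flipAt zero (suc j) (true ∷ x)  _ = cong suc (distance-flip (flip-flipAt j x))
distance-flipAt (suc i) zero (false ∷ x) _ = cong suc (distance-flip (flip-sym (flip-flipAt i x)))
distance-flipAt (suc i) zero (true ∷ x)  _ = cong suc (distance-flip (flip-sym (flip-flipAt i x)))
distance-flipAt (suc i) (suc j) (false ∷ x) i≢j = distance-flipAt i j x (i≢j ∘ cong suc)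
distance-flipAt (suc i) (suc j) (true ∷ x)  i≢j = distance-flipAt i j x (i≢j ∘ cong suc)

flip-not : {x y : Cube n} → Flip x y → Flip (Vec.map not x) (Vec.map not y)
flip-not here      = here
flip-not (there r) = there (flip-not r)

flip-at : {x y : Cube n} → Flip x y → ∃[ i ] y ≡ flipAt i x
flip-at here = zero , Eq.refl
flip-at (there r) with i , Eq.refl ← flip-at r = suc i , Eq.refl

rotate-flipAt : ∀ (i : Fin n) x → rotate (flipAt i x) ≡ flipAt (next i) (rotate x)
rotate-flipAt i x = lookup-ext λ k → Eq.trans (lookup-rotate (flipAt i x) k) (at k (prev k Fin.≟ i))
  where
  at : ∀ k → Dec (prev k ≡ i) → lookup (flipAt i x) (prev k) ≡ lookup (flipAt (next i) (rotate x)) k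
  at k (yes Eq.refl) rewrite next-prev k = Eq.trans (lookup-flipAt (prev k) x Eq.refl)
    (Eq.sym (lookup-flipAt k (rotate x) (lookup-rotate x k)))
  at k (no ne) = Eq.trans (Vec.lookup∘updateAt′ (prev k) i ne x)
    (Eq.sym (Eq.trans (Vec.lookup∘updateAt′ k (next i) (λ { Eq.refl → ne (prev-next i) }) (rotate x)) (lookup-rotate x k)))

flip-rotate : {x y : Cube n} → Flip x y → Flip (rotate x) (rotate y)
flip-rotate {x = x} r with i , Eq.refl ← flip-at r =
  subst (Flip (rotate x)) (Eq.sym (rotate-flipAt i x)) (flip-flipAt (next i) (rotate x))

rotate-pole : ∀ b → rotate (pole {n} b) ≡ pole b
rotate-pole b = lookup-ext λ i →
  Eq.trans (lookup-rotate (pole b) i) (Eq.trans (Vec.lookup-replicate (prev i) b) (Eq.sym (Vec.lookup-replicate i b)))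

setB-pole : ∀ n b → setB (pole {n} b) ≡ setA (pole {n} b)
setB-pole n b = cong (edges (pole {n} b)) (rotate-pole b)

rotate-near : ∀ (i : Fin n) b → rotate (near i b) ≡ near (next i) b
rotate-near i b = Eq.trans (rotate-flipAt i (pole b)) (cong (flipAt (next i)) (rotate-pole b))

edges-adjacent : ∀ (x y S U : Cube n) {k l} → distance (Vec.map not x) (Vec.map not y) ≡ k → distance S U ≡ l →
                 k + l ≡ 2 → Adjacent n (edges x S) (edges y U)
edges-adjacent x y S U e e′ s = Eq.trans (distance-++ (Vec.map not x) (Vec.map not y) S U) (Eq.trans (cong₂ _+_ e e′) s)

adjacent-sym : ∀ n (B C : EdgeSet n) → Adjacent n B C → Adjacent n C B
adjacent-sym n B C e = Eq.trans (cong ∣_∣ (Subset.∪-comm (C ─ B) (B ─ C))) e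

module _ {m : ℕ} where
  open Glued {m} (Adjacent (suc (suc (suc m)))) (λ {B} {C} → adjacent-sym (suc (suc (suc m))) B C)
    (λ b → setA {suc (suc (suc m))} (pole b))

  whirl-sides : TwoCubes setA setB
  whirl-sides = record
    { F = record
      { edge = λ {u} {v} r → edges-adjacent u v u v (distance-flip (flip-not r)) (distance-flip r) Eq.refl
      ; at-pole = λ _ → Eq.refl }
    ; G = record
      { edge = λ {u} {v} r → edges-adjacent u v (rotate u) (rotate v)
                               (distance-flip (flip-not r)) (distance-flip (flip-rotate r)) Eq.refl
      ; at-pole = setB-pole (suc (suc (suc m))) }
    -- The rim parts agree; among the spokes the exceptional one moves from `i` to `next i`, which
    -- changes two.
    ; bridge = λ i b → edges-adjacent (near i b) (near i b) (near i b) (rotate (near i b)) (distance-refl (Vec.map not (near i b)))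
        (Eq.trans (cong (distance (near i b)) (rotate-near i b)) (distance-flipAt i (next i) (pole b) (≢-sym (next-≢ i)))) Eq.refl
    }

  whirl-spanning-connected : SpanningConnected setA setB
  whirl-spanning-connected = spanning-connected whirl-sides
    -- As sets of indices, `x` is {0, 1}, `y` is {0} and `rotate y` is {1}: the two edge sets differ
    -- in rim edge 1 and spoke 0.
    (edges-adjacent x y x (rotate y)
      (distance-flip (flip-not (flip-sym (flip-flipAt (suc zero) y))))
      (Eq.trans (cong (distance x) (rotate-near zero false)) (distance-flip (flip-sym (flip-flipAt zero (near {suc (suc (suc m))} (suc zero) false)))))
      Eq.refl)
    where
    x y : Cube (suc (suc (suc m)))
    y = near zero false
    x = flipAt (suc zero) y

-- From spanning tours to Hamiltonian paths

path-linked : ∀ {x y l} → Path {V} R x y l → Linked R l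
path-linked stop            = [-]
path-linked (r ▸ stop)      = r ∷ [-]
path-linked (r ▸ π@(_ ▸ _)) = r ∷ path-linked π

path-last : ∀ {x y l} → Path {V} R x y l → ∃[ k ] l ≡ k ++ [ y ]
path-last stop            = [] , Eq.refl
path-last {x = x} (_ ▸ π) with k , Eq.refl ← path-last π = x ∷ k , Eq.refl

path-ends : ∀ {x y l} → x ≢ y → Path {V} R x y l → ∃[ k ] l ≡ x ∷ k ++ [ y ]
path-ends x≢y stop    = contradiction Eq.refl x≢y
path-ends {x = x} _ (_ ▸ π) with k , Eq.refl ← path-last π = k , Eq.refl

-- A repetition-free list of all base-cobases

edges-injective : ∀ (x y S U : Cube n) → edges x S ≡ edges y U → x ≡ y × S ≡ U
edges-injective x y _ _ e =
  Eq.trans (Eq.sym (not-not x)) (Eq.trans (cong (Vec.map not) (Vec.++-injectiveˡ (Vec.map not x) _ e)) (not-not y)) ,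
  Vec.++-injectiveʳ (Vec.map not x) _ e

-- A set in both families has a word invariant under the cyclic shift; hence the two cubes meet only
-- in the poles.
rotate-fixed : ∀ (x : Cube (suc n)) → x ≡ rotate x → x ≡ pole (lookup x zero)
rotate-fixed x e = lookup-ext λ i → Eq.trans
  (next-induction (λ j → lookup x j ≡ lookup x zero) zero Eq.refl
    (λ j p → Eq.trans (Eq.trans (cong (λ z → lookup z (next j)) e) (lookup-rotate-next x j)) p) i)
  (Eq.sym (Vec.lookup-replicate i (lookup x zero)))

cube-complete : ∀ (v : Cube n) → v ∈ cube n
cube-complete []          = here Eq.refl
cube-complete (false ∷ v) = ∈-++⁺ˡ (∈-map⁺ (false ∷_) (cube-complete v))
cube-complete {suc n} (true ∷ v) = ∈-++⁺ʳ (map (false ∷_) (cube n)) (∈-map⁺ (true ∷_) (cube-complete v))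

∈-extract : ∀ {A : Set} {x : A} {L} → x ∈ L → ∃[ M ] L ↭ x ∷ M
∈-extract {x = x} p with h , t , Eq.refl ← ∈-∃++ p = h ++ t , shift x h t

cube-interior : ∀ n → ∃[ I ] cube (suc n) ↭ pole false ∷ pole true ∷ I
cube-interior n with ∈-extract (cube-complete (pole {suc n} false))
... | M , p with ∈-resp-↭ p (cube-complete (pole {suc n} true))
...   | there q with I , p′ ← ∈-extract q = I , ↭-trans p (prep _ p′)

interior-pole : ∀ {I : List (Cube (suc n))} → Unique (pole false ∷ pole true ∷ I) → ∀ b → ¬ pole b ∈ I
interior-pole ((_ ∷ p) ∷ _) false q = All.lookup p q Eq.refl
interior-pole (_ ∷ p ∷ _)   true  q = All.lookup p q Eq.refl

module _ {m : ℕ} where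
  private
    n′ : ℕ
    n′ = suc (suc (suc m))

    I : List (Cube n′)
    I = proj₁ (cube-interior _)

    interior : cube n′ ↭ pole false ∷ pole true ∷ I
    interior = proj₂ (cube-interior _)

    interior-unique : Unique (pole false ∷ pole true ∷ I)
    interior-unique = Unique-resp-↭ interior (cube-unique n′)

    P : Bool → EdgeSet n′
    P b = setA (pole {n′} b)

  open Glued {m} (Adjacent n′) (λ {B} {C} → adjacent-sym n′ B C) P

  -- The poles enter through `setA` alone, since `I` consists of the remaining words.
  base-cobases : List (EdgeSet n′)
  base-cobases = map setA (cube n′) ++ map setB I

  base-cobases-unique : Unique base-cobases
  base-cobases-unique with _ ∷ _ ∷ U ← interior-unique = Unique.++⁺
    (Unique.map⁺ (λ {x} {y} e → proj₁ (edges-injective x y x y e)) (cube-unique n′))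
    (Unique.map⁺ (λ {x} {y} e → proj₁ (edges-injective x y (rotate x) (rotate y) e)) U)
    λ (p , q) → disjoint (∈-map⁻ setA p) (∈-map⁻ setB q)
    where
    disjoint : ∀ {B} → (∃[ x ] x ∈ cube n′ × B ≡ setA x) → ¬ (∃[ y ] y ∈ I × B ≡ setB y)
    disjoint (x , _ , e) (y , y∈I , e′) with Eq.refl , r ← edges-injective x y x (rotate y) (Eq.trans (Eq.sym e) e′) =
      interior-pole interior-unique (lookup x zero) (subst (_∈ I) (rotate-fixed x r) y∈I)

  pole∈ : ∀ b → P b ∈ base-cobases
  pole∈ b = ∈-++⁺ˡ (∈-map⁺ setA (cube-complete (pole {n′} b)))

  base-cobases-complete : ∀ B → IsBaseCobase n′ B → B ∈ base-cobases
  base-cobases-complete B bc with base-cobase-forms B bc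
  ... | x , inj₁ Eq.refl = ∈-++⁺ˡ (∈-map⁺ setA (cube-complete x))
  ... | x , inj₂ Eq.refl with ∈-resp-↭ interior (cube-complete x)
  ...   | here Eq.refl         = subst (_∈ base-cobases) (Eq.sym (setB-pole n′ false)) (pole∈ false)
  ...   | there (here Eq.refl) = subst (_∈ base-cobases) (Eq.sym (setB-pole n′ true)) (pole∈ true)
  ...   | there (there x∈I)    = ∈-++⁺ʳ (map setA (cube n′)) (∈-map⁺ setB x∈I)

  base-cobases-sound : ∀ {B} → B ∈ base-cobases → IsBaseCobase n′ B
  base-cobases-sound p with ∈-++⁻ (map setA (cube n′)) p
  ... | inj₁ q with x , _ , Eq.refl ← ∈-map⁻ setA q = setA-base-cobase x
  ... | inj₂ q with x , _ , Eq.refl ← ∈-map⁻ setB q = setB-base-cobase x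

  spanning-support : ∀ {K} → P false ∷ P true ∷ K ↭ map setA (cube n′) ++ map setB (cube n′) →
                     K ↭ base-cobases
  spanning-support {K} p = drop-∷ (drop-∷ (begin
    P false ∷ P true ∷ K
      ↭⟨ p ⟩
    map setA (cube n′) ++ map setB (cube n′)
      ↭⟨ ++⁺ˡ (map setA (cube n′)) (Perm.map⁺ setB interior) ⟩
    map setA (cube n′) ++ setB (pole {n′} false) ∷ setB (pole {n′} true) ∷ map setB I
      ≡⟨ cong₂ (λ a b → map setA (cube n′) ++ a ∷ b ∷ map setB I) (setB-pole n′ false) (setB-pole n′ true) ⟩
    map setA (cube n′) ++ P false ∷ P true ∷ map setB I
      ↭⟨ shifts (map setA (cube n′)) (P false ∷ P true ∷ []) ⟩
    P false ∷ P true ∷ base-cobases ∎))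
    where open PermutationReasoning

  -- The vertex list of the tour is a permutation of `base-cobases`, from which soundness,
  -- distinctness and completeness carry over.
  hamiltonian : ∀ {u v} → u ≢ v → Spanning setA setB u v → HamiltonianPath n′ u v
  hamiltonian u≢v (K , (l , π , p) , q) with path-ends u≢v π
  ... | mid , Eq.refl = mid ,
    All.tabulate (λ z∈l → base-cobases-sound (∈-resp-↭ l↭ z∈l)) ,
    path-linked π ,
    Unique-resp-↭ (↭-sym l↭) base-cobases-unique ,
    λ B bc → ∈-resp-↭ (↭-sym l↭) (base-cobases-complete B bc)
    where
    l↭ = ↭-trans p (spanning-support q)

  connect : ∀ u v → IsBaseCobase n′ u → IsBaseCobase n′ v → u ≢ v → HamiltonianPath n′ u v
  connect u v bu bv u≢v with base-cobase-forms u bu | base-cobase-forms v bv | whirl-spanning-connected {m}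
  ... | x , inj₁ Eq.refl | y , inj₁ Eq.refl | A , _ , _ = hamiltonian u≢v (A x y λ { Eq.refl → u≢v Eq.refl })
  ... | x , inj₂ Eq.refl | y , inj₂ Eq.refl | _ , B , _ = hamiltonian u≢v (B x y λ { Eq.refl → u≢v Eq.refl })
  ... | x , inj₁ Eq.refl | y , inj₂ Eq.refl | _ , _ , C = hamiltonian u≢v (C x y u≢v)
  ... | x , inj₂ Eq.refl | y , inj₁ Eq.refl | _ , _ , C = hamiltonian u≢v (spanning-sym (C y x (≢-sym u≢v)))

theorem4p9 : (n : Data.Nat.ℕ) → 3 ≤ n → (u v : EdgeSet n) → IsBaseCobase n u → IsBaseCobase n v → u ≢ v → HamiltonianPath n u v
theorem4p9 (suc (suc (suc m))) (s≤s (s≤s (s≤s z≤n))) = connect
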